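{- Let $G$ be a subcubic graph without isolated vertices. Then $$\nu_{ac}(G) \geq \frac{1}{4}\left( n(G) - \kappa_G(K_{2,3}) - \kappa_G(K_4^+) - 2\kappa_G(K_{3,3}) \right).$$
   Context: All graphs are finite, simple, and undirected. A graph is subcubic if its maximum degree is at most $3$. A matching $M$ in a graph $G$ is acyclic if the subgraph of $G$ induced by the set of vertices incident to some edge of $M$ is a forest; the acyclic matching number $\nu_{ac}(G)$ is the maximum size of an acyclic matching in $G$. $n(G)$ denotes the number of vertices of $G$. For graphs $G$ and $H$, $\kappa_G(H)$ denotes the number of connected components of $G$ that are isomorphic to $H$. $K_4^+$ denotes the graph obtained from the complete graph $K_4$ by subdividing one edge once (i.e., replacing one edge by a path of length $2$ through a new vertex). -}

module Defs where

open import Data.Bool using (Bool; true; false; if_then_else_; _∨_; _∧_)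
open import Data.Nat using (ℕ; zero; suc; _+_; _*_; _≤_; _≡ᵇ_)
open import Data.Fin using (Fin; toℕ)
open import Data.Product using (Σ; ∃; _×_; _,_)
open import Data.List using (List; []; _∷_; _++_; [_]; length; map; allFin; concatMap)
open import Data.Nat.ListAction using (sum)
open import Data.List.Membership.Propositional using (_∈_)
open import Data.List.Relation.Unary.Unique.Propositional using (Unique)
open import Data.List.Relation.Unary.All using (All)
open import Data.List.Relation.Unary.Linked using (Linked)
open import Data.Vec using (Vec; lookup)
open import Function.Bundles using (_⇔_)
open import Relation.Binary.PropositionalEquality using (_≡_)
open import Relation.Nullary using (¬_)

record Graph (n : ℕ) : Set where
  field
    adj    : Fin n → Fin n → Bool
    sym    : ∀ i j → adj i j ≡ adj j i
    irrefl : ∀ i → adj i i ≡ false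

open Graph public

E : ∀ {n} → Graph n → Fin n → Fin n → Set
E G i j = adj G i j ≡ true

degree : ∀ {n} → Graph n → Fin n → ℕ
degree {n} G i = sum (map (λ j → if adj G i j then 1 else 0) (allFin n))

Subcubic : ∀ {n} → Graph n → Set
Subcubic {n} G = ∀ (i : Fin n) → degree G i ≤ 3

NoIsolatedVertices : ∀ {n} → Graph n → Set
NoIsolatedVertices {n} G = ∀ (i : Fin n) → ∃ λ j → E G i j

record Cycle {n} (G : Graph n) : Set where
  field
    start  : Fin n
    mid    : List (Fin n)
    end    : Fin n
    long   : 1 ≤ length mid
    unique : Unique (start ∷ mid ++ [ end ])
    linked : Linked (E G) (start ∷ mid ++ [ end ])
    closes : E G end start

vertices : ∀ {n} {G : Graph n} → Cycle G → List (Fin n)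
vertices c = Cycle.start c ∷ Cycle.mid c ++ [ Cycle.end c ]

InducedForest : ∀ {n} → Graph n → (Fin n → Set) → Set
InducedForest G S = ¬ (Σ (Cycle G) λ c → All S (vertices c))

endpoints : ∀ {n} → List (Fin n × Fin n) → List (Fin n)
endpoints = concatMap (λ { (u , v) → u ∷ v ∷ [] })

IsMatching : ∀ {n} → Graph n → List (Fin n × Fin n) → Set
IsMatching G M = All (λ { (u , v) → E G u v }) M × Unique (endpoints M)

IsAcyclicMatching : ∀ {n} → Graph n → List (Fin n × Fin n) → Set
IsAcyclicMatching G M = IsMatching G M × InducedForest G (λ v → v ∈ endpoints M)

Subset : ℕ → Set
Subset n = Vec Bool n

_∈ₛ_ : ∀ {n} → Fin n → Subset n → Set
v ∈ₛ C = lookup C v ≡ true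

data Walk {n} (G : Graph n) : Fin n → Fin n → Set where
  here : ∀ {u} → Walk G u u
  step : ∀ {u v w} → E G u v → Walk G v w → Walk G u w

IsComponent : ∀ {n} → Graph n → Subset n → Set
IsComponent {n} G C =
  (∃ λ v → v ∈ₛ C) ×
  (∀ u v → u ∈ₛ C → E G u v → v ∈ₛ C) ×
  (∀ u v → u ∈ₛ C → v ∈ₛ C → Walk G u v)

InducedIso : ∀ {n k} → Graph n → Subset n → (Fin k → Fin k → Bool) → Set
InducedIso {n} {k} G C h =
  Σ (Fin k → Fin n) λ f →
    (∀ i j → f i ≡ f j → i ≡ j) ×
    (∀ v → v ∈ₛ C → ∃ λ i → f i ≡ v) ×
    (∀ i → f i ∈ₛ C) ×
    (∀ i j → adj G (f i) (f j) ≡ h i j)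

CountComponents : ∀ {n k} → Graph n → (Fin k → Fin k → Bool) → ℕ → Set
CountComponents {n} G h c =
  Σ (List (Subset n)) λ L →
    Unique L × length L ≡ c ×
    (∀ C → C ∈ L ⇔ (IsComponent G C × InducedIso G C h))

edgeIn : List (ℕ × ℕ) → ℕ → ℕ → Bool
edgeIn [] a b = false
edgeIn ((x , y) ∷ es) a b =
  ((x ≡ᵇ a) ∧ (y ≡ᵇ b)) ∨ ((x ≡ᵇ b) ∧ (y ≡ᵇ a)) ∨ edgeIn es a b

fromEdges : ∀ {k} → List (ℕ × ℕ) → Fin k → Fin k → Bool
fromEdges es i j = edgeIn es (toℕ i) (toℕ j)

K23 : Fin 5 → Fin 5 → Bool
K23 = fromEdges ((0 , 2) ∷ (0 , 3) ∷ (0 , 4) ∷ (1 , 2) ∷ (1 , 3) ∷ (1 , 4) ∷ [])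

K33 : Fin 6 → Fin 6 → Bool
K33 = fromEdges ((0 , 3) ∷ (0 , 4) ∷ (0 , 5) ∷ (1 , 3) ∷ (1 , 4) ∷ (1 , 5)
                 ∷ (2 , 3) ∷ (2 , 4) ∷ (2 , 5) ∷ [])

-- K_4^+: K_4 on {0,1,2,3} with the edge 01 subdivided by vertex 4
K4plus : Fin 5 → Fin 5 → Bool
K4plus = fromEdges ((0 , 2) ∷ (0 , 3) ∷ (1 , 2) ∷ (1 , 3) ∷ (2 , 3)
                    ∷ (0 , 4) ∷ (1 , 4) ∷ [])

{-# OPTIONS --safe #-}
module Submission where

-- Matched edges are peeled off one at a time: an edge u v may be added to an acyclic matching of a
-- smaller vertex set T when u has no and v has at most one neighbour in T, since a cycle would then
-- avoid u and hence v. So it suffices to find, in the alive set S, a few vertices X whose deletion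
-- pays four vertices per matched edge. Exceptional pieces left in S ∖ X (isolated vertices, K₂,₃ and
-- K₄⁺; K₃,₃ is cubic) must be attached to X, and the choice of X keeps their number within the slack.
-- First pendant K₄⁺ and K₂,₃ with at most two attached legs are reduced, then leaves, then vertices of
-- degree two. If S is cubic, deleting one vertex loses only a single unit, which is recovered because
-- |S| is even.

open import Defs renaming (sym to adj-sym)
open import Data.Bool using (Bool; true; false; if_then_else_; _∨_; _∧_)
import Data.Bool.Properties as Bool
open import Data.Nat using (ℕ; zero; suc; _+_; _*_; _≤_; _<_; _≡ᵇ_; z≤n; s≤s)
open import Data.Nat.Properties hiding (_≟_)
open import Data.Nat.Divisibility using (_∣_; _∣0; _∣?_; ∣m∣n⇒∣m+n; ∣m+n∣m⇒∣n; m∣m*n)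
open import Data.Nat.ListAction using (sum)
open import Data.Nat.Tactic.RingSolver using (solve-∀)
open import Data.Fin using (Fin; zero; suc; toℕ)
import Data.Fin.Properties as Fin
open import Data.Fin.Patterns
open import Data.Product using (Σ; ∃; ∃₂; _×_; _,_; proj₁; proj₂)
open import Data.Sum as Sum using (_⊎_; inj₁; inj₂)
open import Data.Empty using (⊥; ⊥-elim)
open import Data.Unit using (⊤; tt)
open import Data.Vec using (Vec; []; _∷_; lookup; tabulate; toList)
import Data.Vec.Properties as Vec
open import Data.List using (List; []; _∷_; _++_; [_]; length; map; allFin; filter)
import Data.List.Properties as List
open import Data.List.Membership.Propositional using (_∈_; _∉_)
open import Data.List.Membership.Propositional.Properties
  using (∈-map⁻; ∈-++⁺ˡ; ∈-++⁺ʳ; ∈-++⁻; ∈-filter⁺; ∈-filter⁻; ∈-∃++; ∈-allFin)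
import Data.List.Membership.DecPropositional as DecMembership
open import Data.List.Relation.Binary.Subset.Propositional using (_⊆_)
open import Data.List.Relation.Unary.Any as Any using (Any; here; there)
open import Data.List.Relation.Unary.All as All using (All; []; _∷_)
open import Data.List.Relation.Unary.All.Properties using (¬Any⇒All¬; all-filter)
open import Data.List.Relation.Unary.AllPairs as Pairs using (AllPairs; []; _∷_)
import Data.List.Relation.Unary.AllPairs.Properties as AllPairs
open import Data.List.Relation.Unary.Unique.Propositional using (Unique)
import Data.List.Relation.Unary.Unique.Propositional.Properties as Unique
open import Data.List.Relation.Unary.Linked using (Linked; _∷_)
open import Function using (_∘_; id; case_of_)
open import Function.Bundles using (Equivalence)
open import Relation.Binary.PropositionalEquality
  using (_≡_; _≢_; refl; sym; ≢-sym; trans; cong; cong₂; subst; subst₂; module ≡-Reasoning)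
open import Relation.Nullary using (¬_; Dec; yes; no; contradiction)
open import Relation.Nullary.Decidable using (¬?; _×-dec_; _→-dec_; map′; from-no; does; dec-true)

-- The induction runs over arbitrary vertex sets. Deleting vertices can create isolated ones, so the
-- single vertex joins the exceptional graphs as a kind of its own. For each kind the order is four
-- times the number of edges taken from it plus its cost: 1 = 0 + 1, 5 = 4 + 1, 6 = 4 + 2. This is
-- where the coefficients of the bound come from. The obstacle is the accounting. Four deleted
-- vertices per edge leave nothing for a new exceptional piece; three leave room for exactly one of
-- cost 1. As the recorded pieces are pairwise disjoint, it is enough in the second case that all of
-- them contain one named vertex. The preliminary removals make this manageable: afterwards a K₂,₃
-- created by a deletion has all three legs on the boundary of the deleted set, and that boundary is
-- so small that the legs are nearly determined. If such a K₂,₃ still spoils a deletion at a vertex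
-- of degree two, its legs reveal another deletion that works.

pattern at0 = here refl
pattern at1 = there at0
pattern at2 = there at1
pattern at3 = there at2
pattern at4 = there at3
pattern at5 = there at4
pattern at6 = there at5

-- Lists without repetitions and linked lists

module _ {A : Set} where

  ⊆-length : {xs ys : List A} → Unique xs → xs ⊆ ys → length xs ≤ length ys
  ⊆-length [] _ = z≤n
  ⊆-length {x ∷ xs} (x∉xs ∷ xs!) xs⊆ys with ∈-∃++ (xs⊆ys at0)
  ... | as , bs , refl = begin
    suc (length xs)              ≤⟨ s≤s (⊆-length xs! rest) ⟩
    suc (length (as ++ bs))      ≡⟨ cong suc (List.length-++ as) ⟩
    suc (length as + length bs)  ≡⟨ +-suc (length as) (length bs) ⟨
    length as + suc (length bs)  ≡⟨ List.length-++ as ⟨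
    length (as ++ x ∷ bs)        ∎
    where
    open ≤-Reasoning
    rest : xs ⊆ as ++ bs
    rest {z} z∈xs with ∈-++⁻ as (xs⊆ys (there z∈xs))
    ... | inj₁ z∈as         = ∈-++⁺ˡ z∈as
    ... | inj₂ (there z∈bs) = ∈-++⁺ʳ as z∈bs
    ... | inj₂ at0          = ⊥-elim (All.lookup x∉xs z∈xs refl)

  ∉-∷ : {x y : A} {xs : List A} → x ≢ y → x ∉ xs → x ∉ y ∷ xs
  ∉-∷ x≢y x∉xs (here x≡y)   = x≢y x≡y
  ∉-∷ x≢y x∉xs (there x∈xs) = x∉xs x∈xs

  ∈-skip : {x y : A} {X L : List A} → x ∉ X → y ∈ X → x ∈ y ∷ L → x ∈ L
  ∈-skip x∉X y∈X at0        = ⊥-elim (x∉X y∈X)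
  ∈-skip x∉X y∈X (there x∈) = x∈

  ∈-tail : {x y : A} {L : List A} → x ≢ y → x ∈ y ∷ L → x ∈ L
  ∈-tail x≢y (here x≡y) = ⊥-elim (x≢y x≡y)
  ∈-tail x≢y (there x∈) = x∈

  unique3 : {a b c : A} → a ≢ b → a ≢ c → b ≢ c → Unique (a ∷ b ∷ c ∷ [])
  unique3 a≢b a≢c b≢c = (a≢b ∷ a≢c ∷ []) ∷ (b≢c ∷ []) ∷ [] ∷ []

  module _ {R : A → A → Set} where

    -- Applied to the vertex list of a cycle: predecessor and successor are the two neighbours, and
    -- uniqueness of the list keeps them apart.
    interior : ∀ {p y w} ys {e} → Linked R (p ∷ y ∷ ys ++ [ e ]) → Unique (p ∷ y ∷ ys ++ [ e ]) →
      w ∈ y ∷ ys → ∃₂ λ q r → q ∈ p ∷ y ∷ ys ++ [ e ] × r ∈ p ∷ y ∷ ys ++ [ e ] × R q w × R w r × q ≢ r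
    interior []       (pRy ∷ yRe ∷ _) ((_ ∷ p≢e ∷ _) ∷ _) at0 = _ , _ , at0 , at2 , pRy , yRe , p≢e
    interior (z ∷ ys) (pRy ∷ yRz ∷ _) ((_ ∷ p≢z ∷ _) ∷ _) at0 = _ , _ , at0 , at2 , pRy , yRz , p≢z
    interior (z ∷ ys) (_ ∷ link) (_ ∷ xs!) (there w∈) with interior ys link xs! w∈
    ... | q , r , q∈ , r∈ , qRw , wRr , q≢r = q , r , there q∈ , there r∈ , qRw , wRr , q≢r

    penultimate : ∀ y ys {e} → Linked R (y ∷ ys ++ [ e ]) → ∃ λ q → q ∈ y ∷ ys × R q e
    penultimate y []       (yRe ∷ _) = y , at0 , yRe
    penultimate y (z ∷ ys) (_ ∷ link) with penultimate z ys link
    ... | q , q∈ , qRe = q , there q∈ , qRe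

-- Adjacency and the degree bound

module Local {n} (G : Graph n) (subcubic : Subcubic G) where

  open DecMembership (Fin._≟_ {n}) using (_∈?_)

  infix 4 _~_ _~?_ _≟_
  infixl 6 _∖_

  _≟_ : (v w : Fin n) → Dec (v ≡ w)
  _≟_ = Fin._≟_

  _~_ : Fin n → Fin n → Set
  _~_ = E G

  _~?_ : ∀ v w → Dec (v ~ w)
  v ~? w = adj G v w Bool.≟ true

  ~-sym : ∀ {v w} → v ~ w → w ~ v
  ~-sym {v} {w} v~w = trans (adj-sym G w v) v~w

  ~⇒≢ : ∀ {v w} → v ~ w → v ≢ w
  ~⇒≢ {v} v~v refl with trans (sym (irrefl G v)) v~v
  ... | ()

  ≁⇒false : ∀ {v w} → ¬ v ~ w → adj G v w ≡ false
  ≁⇒false v≁w = Bool.¬-not v≁w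

  degree≡length : ∀ v xs →
    sum (map (λ w → if adj G v w then 1 else 0) xs) ≡ length (filter (v ~?_) xs)
  degree≡length v [] = refl
  degree≡length v (x ∷ xs) with adj G v x
  ... | true  = cong suc (degree≡length v xs)
  ... | false = degree≡length v xs

  neighbours≤3 : ∀ {v xs} → Unique xs → All (v ~_) xs → length xs ≤ 3
  neighbours≤3 {v} {xs} xs! v~xs = begin
    length xs                            ≤⟨ ⊆-length xs! (λ x∈ → ∈-filter⁺ (v ~?_) (∈-allFin _) (All.lookup v~xs x∈)) ⟩
    length (filter (v ~?_) (allFin n))   ≡⟨ degree≡length v (allFin n) ⟨
    degree G v                           ≤⟨ subcubic v ⟩
    3                                    ∎
    where open ≤-Reasoning

  -- A fourth neighbour would exceed degree three. In this form the degree bound enters nearly every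
  -- later argument: three known neighbours exhaust a neighbourhood.
  saturated : ∀ {v a b c} → v ~ a → v ~ b → v ~ c → a ≢ b → a ≢ c → b ≢ c →
    ∀ {w} → v ~ w → w ∈ a ∷ b ∷ c ∷ []
  saturated {v} {a} {b} {c} v~a v~b v~c a≢b a≢c b≢c {w} v~w with w ∈? (a ∷ b ∷ c ∷ [])
  ... | yes w∈ = w∈
  ... | no  w∉ = contradiction
    (neighbours≤3 (¬Any⇒All¬ _ w∉ ∷ unique3 a≢b a≢c b≢c) (v~w ∷ v~a ∷ v~b ∷ v~c ∷ []))
    λ { (s≤s (s≤s (s≤s ()))) }

  -- Alive vertices

  opaque

    _∖_ : List (Fin n) → List (Fin n) → List (Fin n)
    S ∖ X = filter (λ v → ¬? (v ∈? X)) S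

  module _ {S X : List (Fin n)} where opaque

    unfolding _∖_

    ∖⁺ : ∀ {v} → v ∈ S → v ∉ X → v ∈ S ∖ X
    ∖⁺ = ∈-filter⁺ (λ v → ¬? (v ∈? X))

    ∖⁻ : ∀ {v} → v ∈ S ∖ X → v ∈ S × v ∉ X
    ∖⁻ = ∈-filter⁻ (λ v → ¬? (v ∈? X))

    ∖-unique : Unique S → Unique (S ∖ X)
    ∖-unique = Unique.filter⁺ (λ v → ¬? (v ∈? X))

    ∖-shrinks : ∀ {v} → v ∈ S → v ∈ X → length (S ∖ X) < length S
    ∖-shrinks v∈S v∈X =
      List.filter-notAll (λ v → ¬? (v ∈? X)) S (Any.map (λ { refl v∉X → v∉X v∈X }) v∈S)

  module _ {S X : List (Fin n)} where

    ∖-⊆ : S ∖ X ⊆ S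
    ∖-⊆ v∈ = proj₁ (∖⁻ v∈)

    ∖-length : Unique S → length S ≤ length (S ∖ X) + length X
    ∖-length S! = ≤-trans (⊆-length S! split) (≤-reflexive (List.length-++ (S ∖ X)))
      where
      split : S ⊆ S ∖ X ++ X
      split {v} v∈S with v ∈? X
      ... | yes v∈X = ∈-++⁺ʳ (S ∖ X) v∈X
      ... | no  v∉X = ∈-++⁺ˡ (∖⁺ v∈S v∉X)

  -- Bounds the degree of `v` inside `S` without counting. `L` may contain repetitions, dead
  -- vertices and non-neighbours, so a list of two entries expresses degree at most two.
  Neighbours⊆ : List (Fin n) → Fin n → List (Fin n) → Set
  Neighbours⊆ S v L = ∀ {w} → w ∈ S → v ~ w → w ∈ L

  neighbours⊆? : ∀ S v L → Dec (Neighbours⊆ S v L)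
  neighbours⊆? S v L = map′ (λ all w∈S → All.lookup all w∈S) (λ nb → All.tabulate (λ w∈S → nb w∈S))
    (All.all? (λ w → (v ~? w) →-dec (w ∈? L)) S)

  Beyond : List (Fin n) → Fin n → List (Fin n) → Set
  Beyond S v L = ∃ λ w → w ∈ S × v ~ w × w ∉ L

  beyond? : ∀ S v L → Beyond S v L ⊎ Neighbours⊆ S v L
  beyond? S v L with Fin.any? (λ w → (w ∈? S) ×-dec (v ~? w) ×-dec ¬? (w ∈? L))
  ... | yes b = inj₁ b
  ... | no ¬b = inj₂ nb
    where
    nb : Neighbours⊆ S v L
    nb {w} w∈S v~w with w ∈? L
    ... | yes w∈L = w∈L
    ... | no  w∉L = ⊥-elim (¬b (w , w∈S , v~w , w∉L))

  -- When there is no third neighbour, the witness just repeats a.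
  third : ∀ S {v a b} → v ~ a → v ~ b → a ≢ b → ∃ λ c → v ~ c × c ≢ b × Neighbours⊆ S v (a ∷ b ∷ c ∷ [])
  third S {v} {a} {b} v~a v~b a≢b with beyond? S v (a ∷ b ∷ [])
  ... | inj₁ (c , _ , v~c , c∉) = c , v~c , (λ { refl → c∉ at1 }) ,
    λ _ → saturated v~a v~b v~c a≢b (λ { refl → c∉ at0 }) (λ { refl → c∉ at1 })
  ... | inj₂ nb = a , v~a , a≢b , λ w∈S v~w → case nb w∈S v~w of λ { at0 → at0 ; at1 → at1 }

  -- Acyclic matchings

  record AcyclicMatching (S : List (Fin n)) (k : ℕ) : Set where
    field
      edges   : List (Fin n × Fin n)
      length≡ : length edges ≡ k
      acyclic : IsAcyclicMatching G edges
      inside  : endpoints edges ⊆ S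

  open AcyclicMatching

  empty-matching : ∀ {S} → AcyclicMatching S 0
  empty-matching = record
    { edges = [] ; length≡ = refl ; inside = λ ()
    ; acyclic = ([] , []) , λ { (_ , () ∷ _) } }

  -- At the two ends of the list the closing edge supplies the missing neighbour; a nonempty `mid`
  -- makes it differ from the other one.
  cycle-neighbours : (c : Cycle G) → ∀ {w} → w ∈ vertices c →
    ∃₂ λ q r → q ∈ vertices c × r ∈ vertices c × w ~ q × w ~ r × q ≢ r
  cycle-neighbours record { mid = m ∷ ms ; unique = (_ ∷ s≢) ∷ m≢ ∷ _ ; linked = s~m ∷ _ ; closes = e~s } at0 =
    m , _ , at1 , there (there (∈-++⁺ʳ ms at0)) , s~m , ~-sym e~s , All.lookup m≢ (∈-++⁺ʳ ms at0)
  cycle-neighbours record { start = s ; mid = m ∷ ms ; unique = s≢ ∷ xs! ; linked = s~m ∷ link ; closes = e~s } (there w∈)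
    with ∈-++⁻ (m ∷ ms) w∈
  ... | inj₁ w∈mid with interior ms (s~m ∷ link) (s≢ ∷ xs!) w∈mid
  ...   | q , r , q∈ , r∈ , q~w , w~r , q≢r = q , r , q∈ , r∈ , ~-sym q~w , w~r , q≢r
  cycle-neighbours record { start = s ; mid = m ∷ ms ; unique = s≢ ∷ xs! ; linked = s~m ∷ link ; closes = e~s } (there w∈)
      | inj₂ at0 with penultimate m ms link
  ...   | q , q∈ , q~e = q , s , there (∈-++⁺ˡ q∈) , at0 , ~-sym q~e , e~s ,
                         λ q≡s → All.lookup s≢ (∈-++⁺ˡ q∈) (sym q≡s)

  -- A cycle through u would need a second neighbour of u, and then one through v would need
  -- two neighbours of v in T.
  match : ∀ {S T k u v} t → T ⊆ S → u ∈ S → v ∈ S → u ∉ T → v ∉ T → u ~ v →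
    Neighbours⊆ T u [] → Neighbours⊆ T v (t ∷ []) →
    AcyclicMatching T k → AcyclicMatching S (suc k)
  match {S} {T} {k} {u} {v} t T⊆S u∈S v∈S u∉T v∉T u~v nu nv
    record { edges = M ; length≡ = eq ; acyclic = (es , M!) , forest ; inside = M⊆T } = record
    { edges   = (u , v) ∷ M
    ; length≡ = cong suc eq
    ; acyclic = (u~v ∷ es , (~⇒≢ u~v ∷ fresh u∉T) ∷ fresh v∉T ∷ M!) , forest′
    ; inside  = λ { at0 → u∈S ; at1 → v∈S ; (there (there w∈)) → T⊆S (M⊆T w∈) }
    }
    where
    fresh : ∀ {w} → w ∉ T → All (w ≢_) (endpoints M)
    fresh w∉T = All.tabulate λ { z∈ refl → w∉T (M⊆T z∈) }

    near-u : ∀ {w} → w ∈ u ∷ v ∷ endpoints M → u ~ w → w ≡ v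
    near-u at0 u~u = ⊥-elim (~⇒≢ u~u refl)
    near-u at1 _   = refl
    near-u (there (there w∈)) u~w with nu (M⊆T w∈) u~w
    ... | ()

    near-v : ∀ {w} → w ∈ u ∷ v ∷ endpoints M → w ≢ u → v ~ w → w ≡ t
    near-v at0 w≢u _   = ⊥-elim (w≢u refl)
    near-v at1 _   v~v = ⊥-elim (~⇒≢ v~v refl)
    near-v (there (there w∈)) _ v~w with nv (M⊆T w∈) v~w
    ... | at0 = refl

    forest′ : InducedForest G (_∈ u ∷ v ∷ endpoints M)
    forest′ (c , c⊆) = forest (c , All.tabulate λ {w} w∈ → case All.lookup c⊆ w∈ of λ
      { at0 → ⊥-elim (u∉c w∈) ; at1 → ⊥-elim (v∉c w∈) ; (there (there w∈M)) → w∈M })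
      where
      u∉c : u ∉ vertices c
      u∉c u∈c with cycle-neighbours c u∈c
      ... | q , r , q∈ , r∈ , u~q , u~r , q≢r =
        q≢r (trans (near-u (All.lookup c⊆ q∈) u~q) (sym (near-u (All.lookup c⊆ r∈) u~r)))

      v∉c : v ∉ vertices c
      v∉c v∈c with cycle-neighbours c v∈c
      ... | q , r , q∈ , r∈ , v~q , v~r , q≢r =
        q≢r (trans (near-v (All.lookup c⊆ q∈) (λ { refl → u∉c q∈ }) v~q)
              (sym (near-v (All.lookup c⊆ r∈) (λ { refl → u∉c r∈ }) v~r)))

  -- Closed copies of the exceptional components

  data Kind : Set where
    point theta k4+ k33 : Kind

  order : Kind → ℕ
  order point = 1
  order theta = 5
  order k4+   = 5
  order k33   = 6

  -- The lists repeat those of `K23`, `K4plus` and `K33` literally, so that `shape` agrees with the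
  -- graphs of the theorem by computation.
  shapeEdges : Kind → List (ℕ × ℕ)
  shapeEdges point = []
  shapeEdges theta = (0 , 2) ∷ (0 , 3) ∷ (0 , 4) ∷ (1 , 2) ∷ (1 , 3) ∷ (1 , 4) ∷ []
  shapeEdges k4+   = (0 , 2) ∷ (0 , 3) ∷ (1 , 2) ∷ (1 , 3) ∷ (2 , 3) ∷ (0 , 4) ∷ (1 , 4) ∷ []
  shapeEdges k33   = (0 , 3) ∷ (0 , 4) ∷ (0 , 5) ∷ (1 , 3) ∷ (1 , 4) ∷ (1 , 5)
    ∷ (2 , 3) ∷ (2 , 4) ∷ (2 , 5) ∷ []

  shape : ∀ κ → Fin (order κ) → Fin (order κ) → Bool
  shape κ = fromEdges (shapeEdges κ)

  -- What remains unpaid when one matched edge pays for four vertices of the piece; a single vertex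
  -- contains no edge and remains unpaid as a whole.
  cost : Kind → ℕ
  cost k33 = 2
  cost _   = 1

  record Copy (κ : Kind) (S : List (Fin n)) (vs : Vec (Fin n) (order κ)) : Set where
    field
      injective : ∀ i j → lookup vs i ≡ lookup vs j → i ≡ j
      member    : ∀ i → lookup vs i ∈ S
      adjacency : ∀ i j → adj G (lookup vs i) (lookup vs j) ≡ shape κ i j

  open Copy

  record Bad (κ : Kind) (S : List (Fin n)) (vs : Vec (Fin n) (order κ)) : Set where
    field
      copy   : Copy κ S vs
      closed : ∀ i → Neighbours⊆ S (lookup vs i) (toList vs)

  open Bad

  NoBad : List (Fin n) → Set
  NoBad S = ∀ κ vs → ¬ Bad κ S vs

  lookup∈ : ∀ {k} (vs : Vec (Fin n) k) i → lookup vs i ∈ toList vs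
  lookup∈ (v ∷ vs) 0F      = at0
  lookup∈ (v ∷ vs) (suc i) = there (lookup∈ vs i)

  index : ∀ {k} (vs : Vec (Fin n) k) {w} → w ∈ toList vs → ∃ λ i → w ≡ lookup vs i
  index (v ∷ vs) at0        = 0F , refl
  index (v ∷ vs) (there w∈) with index vs w∈
  ... | i , eq = suc i , eq

  toList-length : ∀ {k} (vs : Vec (Fin n) k) → length (toList vs) ≡ k
  toList-length []       = refl
  toList-length (v ∷ vs) = cong suc (toList-length vs)

  opaque

    anyVec? : ∀ {k} {P : Vec (Fin n) k → Set} → (∀ vs → Dec (P vs)) → Dec (∃ P)
    anyVec? {zero}  P? = map′ (λ p → [] , p) (λ { ([] , p) → p }) (P? [])
    anyVec? {suc k} P? = map′ (λ { (v , vs , p) → v ∷ vs , p }) (λ { (v ∷ vs , p) → v , vs , p })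
      (Fin.any? λ v → anyVec? λ vs → P? (v ∷ vs))

  copy? : ∀ κ S vs → Dec (Copy κ S vs)
  copy? κ S vs = map′
    (λ { (i , m , a) → record { injective = i ; member = m ; adjacency = a } })
    (λ c → injective c , member c , adjacency c)
    ((Fin.all? λ i → Fin.all? λ j → (lookup vs i ≟ lookup vs j) →-dec (i Fin.≟ j))
      ×-dec (Fin.all? λ i → lookup vs i ∈? S)
      ×-dec (Fin.all? λ i → Fin.all? λ j → adj G (lookup vs i) (lookup vs j) Bool.≟ shape κ i j))

  bad? : ∀ κ S vs → Dec (Bad κ S vs)
  bad? κ S vs = map′ (λ { (c , cl) → record { copy = c ; closed = cl } }) (λ b → copy b , closed b)
    (copy? κ S vs ×-dec Fin.all? λ i → neighbours⊆? S (lookup vs i) (toList vs))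

  anyKind? : {P : Kind → Set} → (∀ κ → Dec (P κ)) → ∃ P ⊎ (∀ κ → ¬ P κ)
  anyKind? P? with P? point | P? theta | P? k4+ | P? k33
  ... | yes p | _     | _     | _     = inj₁ (point , p)
  ... | no _  | yes p | _     | _     = inj₁ (theta , p)
  ... | no _  | no _  | yes p | _     = inj₁ (k4+ , p)
  ... | no _  | no _  | no _  | yes p = inj₁ (k33 , p)
  ... | no ¬p | no ¬t | no ¬k | no ¬l = inj₂ λ { point → ¬p ; theta → ¬t ; k4+ → ¬k ; k33 → ¬l }

  opaque

    findBad : ∀ S → (∃₂ λ κ vs → Bad κ S vs) ⊎ NoBad S
    findBad S = Sum.map id (λ none κ vs b → none κ (vs , b)) (anyKind? λ κ → anyVec? (bad? κ S))

  copy-mono : ∀ {κ S T vs} → T ⊆ S → Copy κ T vs → Copy κ S vs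
  copy-mono T⊆S c = record { injective = injective c ; member = λ i → T⊆S (member c i) ; adjacency = adjacency c }

  edge : ∀ {κ S vs} → Copy κ S vs → ∀ i j → shape κ i j ≡ true → lookup vs i ~ lookup vs j
  edge c i j h = trans (adjacency c i j) h

  distinct : ∀ {κ S vs} → Copy κ S vs → ∀ i j → i ≢ j → lookup vs i ≢ lookup vs j
  distinct c i j i≢j eq = i≢j (injective c i j eq)

  no-edge : ∀ {κ S vs} → Copy κ S vs → ∀ i j → shape κ i j ≡ false → ¬ lookup vs i ~ lookup vs j
  no-edge c i j h i~j = case trans (sym h) (trans (sym (adjacency c i j)) i~j) of λ ()

  degree≥2 : ∀ κ → κ ≢ point → ∀ i → ∃₂ λ j k → j ≢ k × shape κ i j ≡ true × shape κ i k ≡ true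
  degree≥2 point κ≢ _ = ⊥-elim (κ≢ refl)
  degree≥2 theta _ 0F = 2F , 3F , (λ ()) , refl , refl
  degree≥2 theta _ 1F = 2F , 3F , (λ ()) , refl , refl
  degree≥2 theta _ 2F = 0F , 1F , (λ ()) , refl , refl
  degree≥2 theta _ 3F = 0F , 1F , (λ ()) , refl , refl
  degree≥2 theta _ 4F = 0F , 1F , (λ ()) , refl , refl
  degree≥2 k4+   _ 0F = 2F , 3F , (λ ()) , refl , refl
  degree≥2 k4+   _ 1F = 2F , 3F , (λ ()) , refl , refl
  degree≥2 k4+   _ 2F = 0F , 1F , (λ ()) , refl , refl
  degree≥2 k4+   _ 3F = 0F , 1F , (λ ()) , refl , refl
  degree≥2 k4+   _ 4F = 0F , 1F , (λ ()) , refl , refl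
  degree≥2 k33   _ 0F = 3F , 4F , (λ ()) , refl , refl
  degree≥2 k33   _ 1F = 3F , 4F , (λ ()) , refl , refl
  degree≥2 k33   _ 2F = 3F , 4F , (λ ()) , refl , refl
  degree≥2 k33   _ 3F = 0F , 1F , (λ ()) , refl , refl
  degree≥2 k33   _ 4F = 0F , 1F , (λ ()) , refl , refl
  degree≥2 k33   _ 5F = 0F , 1F , (λ ()) , refl , refl

  k33-cubic : ∀ i → ∃ λ j → ∃ λ k → ∃ λ l → (j ≢ k × j ≢ l × k ≢ l) ×
    shape k33 i j ≡ true × shape k33 i k ≡ true × shape k33 i l ≡ true
  k33-cubic 0F = 3F , 4F , 5F , ((λ ()) , (λ ()) , λ ()) , refl , refl , refl
  k33-cubic 1F = 3F , 4F , 5F , ((λ ()) , (λ ()) , λ ()) , refl , refl , refl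
  k33-cubic 2F = 3F , 4F , 5F , ((λ ()) , (λ ()) , λ ()) , refl , refl , refl
  k33-cubic 3F = 0F , 1F , 2F , ((λ ()) , (λ ()) , λ ()) , refl , refl , refl
  k33-cubic 4F = 0F , 1F , 2F , ((λ ()) , (λ ()) , λ ()) , refl , refl , refl
  k33-cubic 5F = 0F , 1F , 2F , ((λ ()) , (λ ()) , λ ()) , refl , refl , refl

  -- K₃,₃ is cubic, so a copy of it uses up all degrees and is closed in the whole graph, not just
  -- in `S`.
  k33-neighbours : ∀ {S vs} → Copy k33 S vs → ∀ i {w} → lookup vs i ~ w → w ∈ toList vs
  k33-neighbours {vs = vs} c i i~w with k33-cubic i
  ... | j , k , l , (j≢k , j≢l , k≢l) , ij , ik , il
    with saturated (edge c i j ij) (edge c i k ik) (edge c i l il)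
           (distinct c j k j≢k) (distinct c j l j≢l) (distinct c k l k≢l) i~w
  ...   | at0 = lookup∈ vs j
  ...   | at1 = lookup∈ vs k
  ...   | at2 = lookup∈ vs l

  -- Without an edge to `X` the piece would already be closed in `S`, against `NoBad S`.
  attached : ∀ {S X κ vs} → NoBad S → Bad κ (S ∖ X) vs → ∃₂ λ i x → x ∈ X × lookup vs i ~ x
  attached {S} {X} {κ} {vs} noBad b with Fin.any? (λ i → Fin.any? λ x → (x ∈? X) ×-dec (lookup vs i ~? x))
  ... | yes (i , x , x∈X , i~x) = i , x , x∈X , i~x
  ... | no none = ⊥-elim (noBad κ vs record
    { copy = copy-mono ∖-⊆ (copy b)
    ; closed = λ i {w} w∈S i~w → closed b i (∖⁺ w∈S λ w∈X → none (i , w , w∈X , i~w)) i~w })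

  -- An upper bound for the outer boundary of `X` in `S`. By `attached`, everything that turns bad
  -- when `X` is deleted meets `O`.
  Frontier : List (Fin n) → List (Fin n) → List (Fin n) → Set
  Frontier S X O = ∀ {b x} → b ∈ S → b ∉ X → x ∈ X → b ~ x → b ∈ O

  module _ {S X : List (Fin n)} where

    bad∈ : ∀ {κ vs} → Bad κ (S ∖ X) vs → ∀ i → lookup vs i ∈ S
    bad∈ b i = ∖-⊆ (member (copy b) i)

    bad∉ : ∀ {κ vs} → Bad κ (S ∖ X) vs → ∀ i → lookup vs i ∉ X
    bad∉ b i = proj₂ (∖⁻ {S} {X} (member (copy b) i))

    attached∈ : ∀ {κ vs O} → NoBad S → Frontier S X O → Bad κ (S ∖ X) vs → ∃ λ i → lookup vs i ∈ O
    attached∈ noBad frontier b with attached noBad b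
    ... | i , x , x∈X , i~x = i , frontier (bad∈ b i) (bad∉ b i) x∈X i~x

    noBad-sealed : NoBad S → Frontier S X [] → NoBad (S ∖ X)
    noBad-sealed noBad frontier κ vs b with attached∈ noBad frontier b
    ... | _ , ()

    leaf∉copy : ∀ {κ vs x} → κ ≢ point → ∀ i → Copy κ (S ∖ X) vs →
      ¬ Neighbours⊆ (S ∖ X) (lookup vs i) (x ∷ [])
    leaf∉copy {κ} κ≢ i c nb with degree≥2 κ κ≢ i
    ... | j , k , j≢k , ij , ik with nb (member c j) (edge c i j ij) | nb (member c k) (edge c i k ik)
    ...   | here ej | here ek = distinct c j k j≢k (trans ej (sym ek))

    leaf∉bad : ∀ {κ vs x} i → Bad κ (S ∖ X) vs → x ∈ S ∖ X → lookup vs i ~ x →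
      ¬ Neighbours⊆ (S ∖ X) (lookup vs i) (x ∷ [])
    leaf∉bad {point} {o ∷ []} 0F b x∈ o~x _ with closed b 0F x∈ o~x
    ... | at0 = ~⇒≢ o~x refl
    leaf∉bad {theta} i b _ _ = leaf∉copy (λ ()) i (copy b)
    leaf∉bad {k4+}   i b _ _ = leaf∉copy (λ ()) i (copy b)
    leaf∉bad {k33}   i b _ _ = leaf∉copy (λ ()) i (copy b)

    -- A new bad piece would have to contain `o`, which is left with the single neighbour `x`; no
    -- exceptional graph has a vertex of degree one.
    noBad-leaf : ∀ {o x} → NoBad S → Frontier S X (o ∷ []) → x ∈ S ∖ X → o ~ x →
      Neighbours⊆ (S ∖ X) o (x ∷ []) → NoBad (S ∖ X)
    noBad-leaf noBad frontier x∈ o~x nb κ vs b with attached∈ noBad frontier b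
    ... | i , here refl = leaf∉bad i b x∈ o~x nb

    -- `attached` asks for an edge from the copy to `X`, but the copy has no spare degree for one.
    k33∉ : ∀ {vs} → NoBad S → ¬ Bad k33 (S ∖ X) vs
    k33∉ noBad b with attached noBad b
    ... | i , x , x∈X , i~x with index _ (k33-neighbours (copy b) i i~x)
    ...   | j , refl = bad∉ b j x∈X

  -- Debts, solutions and the removal of bad components

  Debt : Set
  Debt = Σ Kind λ κ → Vec (Fin n) (order κ)

  support : Debt → List (Fin n)
  support (_ , vs) = toList vs

  Apart : Debt → Debt → Set
  Apart d e = ∀ {w} → w ∈ support d → w ∉ support e

  total : List Debt → ℕ
  total = sum ∘ map (cost ∘ proj₁)

  -- The debts are disjoint bad pieces that justify the deficit; they need not be all of them. The
  -- comparison with the number of components is postponed to the very end, so the induction never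
  -- counts components.
  record Solution (S : List (Fin n)) : Set where
    field
      size     : ℕ
      matching : AcyclicMatching S size
      debts    : List Debt
      bads     : All (λ d → Bad (proj₁ d) S (proj₂ d)) debts
      apart    : AllPairs Apart debts
      bound    : length S ≤ 4 * size + total debts

  matching-mono : ∀ {S T k} → T ⊆ S → AcyclicMatching T k → AcyclicMatching S k
  matching-mono T⊆S M = record
    { edges = edges M ; length≡ = length≡ M ; acyclic = acyclic M ; inside = T⊆S ∘ inside M }

  module _ {S κ vs} (b : Bad κ S vs) where

    bad-no-escape : ∀ i → Neighbours⊆ (S ∖ toList vs) (lookup vs i) []
    bad-no-escape i w∈ i~w = ⊥-elim (proj₂ (∖⁻ {S} w∈) (closed b i (∖-⊆ w∈) i~w))

    bad-edge : ∀ {k} i j → shape κ i j ≡ true →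
      AcyclicMatching (S ∖ toList vs) k → AcyclicMatching S (suc k)
    bad-edge i j ij = match (lookup vs i) ∖-⊆ (member (copy b) i) (member (copy b) j)
      (λ i∈ → proj₂ (∖⁻ {S} i∈) (lookup∈ vs i)) (λ j∈ → proj₂ (∖⁻ {S} j∈) (lookup∈ vs j)) (edge (copy b) i j ij)
      (bad-no-escape i) (λ w∈ j~w → ⊥-elim (case bad-no-escape j w∈ j~w of λ ()))

  -- No edge joins a closed piece to the rest of `S`, so restoring it cannot open another one.
  bad-outside : ∀ {S κ κ′ vs vs′} → Bad κ S vs → Bad κ′ (S ∖ toList vs) vs′ → Bad κ′ S vs′
  bad-outside {S} {vs = vs} {vs′} b b′ = record { copy = copy-mono ∖-⊆ (copy b′) ; closed = cl }
    where
    cl : ∀ i → Neighbours⊆ S (lookup vs′ i) (toList vs′)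
    cl i {w} w∈S i~w with w ∈? toList vs
    ... | no  w∉B = closed b′ i (∖⁺ w∈S w∉B) i~w
    ... | yes w∈B with index vs w∈B
    ...   | j , refl = ⊥-elim (bad∉ {S} {toList vs} b′ i (closed b j (bad∈ b′ i) (~-sym i~w)))

  matched : Kind → ℕ
  matched point = 0
  matched _     = 1

  -- With equality for every kind, cutting off a bad component loses nothing: one edge pays for four
  -- vertices and the debt for the others.
  order-bound : ∀ κ → order κ ≡ 4 * matched κ + cost κ
  order-bound point = refl
  order-bound theta = refl
  order-bound k4+   = refl
  order-bound k33   = refl

  peel-matching : ∀ κ {S vs k} → Bad κ S vs → AcyclicMatching (S ∖ toList vs) k →
    AcyclicMatching S (matched κ + k)
  peel-matching point b = matching-mono ∖-⊆
  peel-matching theta b = bad-edge b 0F 2F refl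
  peel-matching k4+   b = bad-edge b 0F 2F refl
  peel-matching k33   b = bad-edge b 0F 3F refl

  peel : ∀ {κ S vs} → Unique S → Bad κ S vs → Solution (S ∖ toList vs) → Solution S
  peel {κ} {S} {vs} S! b s = record
    { size     = matched κ + size
    ; matching = peel-matching κ b matching
    ; debts    = (κ , vs) ∷ debts
    ; bads     = b ∷ All.map (bad-outside b) bads
    ; apart    = All.map (λ b′ {w} w∈B w∈B′ → disjoint b′ w∈B w∈B′) bads ∷ apart
    ; bound    = begin
        length S                                                  ≤⟨ ∖-length S! ⟩
        length (S ∖ toList vs) + length (toList vs)               ≡⟨ cong (length (S ∖ toList vs) +_) (toList-length vs) ⟩
        length (S ∖ toList vs) + order κ                          ≤⟨ +-monoˡ-≤ (order κ) bound ⟩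
        4 * size + total debts + order κ                          ≡⟨ cong (4 * size + total debts +_) (order-bound κ) ⟩
        4 * size + total debts + (4 * matched κ + cost κ)         ≡⟨ rearrange size (total debts) (matched κ) (cost κ) ⟩
        4 * (matched κ + size) + (cost κ + total debts)           ∎
    }
    where
    open Solution s
    open ≤-Reasoning
    rearrange : ∀ s t m c → 4 * s + t + (4 * m + c) ≡ 4 * (m + s) + (c + t)
    rearrange = solve-∀
    disjoint : ∀ {d} → Bad (proj₁ d) (S ∖ toList vs) (proj₂ d) → Apart (κ , vs) d
    disjoint {d} b′ w∈B w∈B′ with index (proj₂ d) w∈B′
    ... | i , refl = bad∉ b′ i w∈B

  -- Deletions paid for by matched edges

  module Reduce {S : List (Fin n)} (S! : Unique S) (solve : ∀ T → Unique T → length T < length S → Solution T) where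

    bound-step : ∀ {X k d} j e → length X + d ≤ 4 * j + e → length (S ∖ X) ≤ 4 * k + d → length S ≤ 4 * (j + k) + e
    bound-step {X} {k} {d} j e X≤ T≤ = begin
      length S                        ≤⟨ ∖-length S! ⟩
      length (S ∖ X) + length X       ≤⟨ +-monoˡ-≤ (length X) T≤ ⟩
      4 * k + d + length X            ≡⟨ rearrange k d (length X) ⟩
      4 * k + (length X + d)          ≤⟨ +-monoʳ-≤ (4 * k) X≤ ⟩
      4 * k + (4 * j + e)             ≡⟨ rearrange′ k j e ⟩
      4 * (j + k) + e                 ∎
      where
      open ≤-Reasoning
      rearrange : ∀ k d x → 4 * k + d + x ≡ 4 * k + (x + d)
      rearrange = solve-∀
      rearrange′ : ∀ k j e → 4 * k + (4 * j + e) ≡ 4 * (j + k) + e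
      rearrange′ = solve-∀

    reduce₀ : ∀ {v} X j → v ∈ S → v ∈ X → NoBad (S ∖ X) → length X ≤ 4 * j →
      (∀ {k} → AcyclicMatching (S ∖ X) k → AcyclicMatching S (j + k)) → Solution S
    reduce₀ X j v∈S v∈X noBad X≤ extend with solve (S ∖ X) (∖-unique S!) (∖-shrinks v∈S v∈X)
    ... | record { debts = (κ , vs) ∷ _ ; bads = b ∷ _ } = ⊥-elim (noBad κ vs b)
    ... | record { size = k ; matching = M ; debts = [] ; bound = T≤ } = record
      { size = j + k ; matching = extend M ; debts = [] ; bads = [] ; apart = []
      ; bound = bound-step {X} {k} j 0 (+-monoˡ-≤ 0 X≤) T≤ }

    -- Disjoint debts that all contain `o` number at most one, and it costs 1 because K₃,₃ cannot
    -- arise. Hence one unit of the budget is set aside.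
    reduce₁ : ∀ {v} o X j → v ∈ S → v ∈ X → NoBad S →
      (∀ κ vs → Bad κ (S ∖ X) vs → o ∈ toList vs) → suc (length X) ≤ 4 * j →
      (∀ {k} → AcyclicMatching (S ∖ X) k → AcyclicMatching S (j + k)) → Solution S
    reduce₁ o X j v∈S v∈X noBad through X≤ extend with solve (S ∖ X) (∖-unique S!) (∖-shrinks v∈S v∈X)
    ... | record { debts = (κ , vs) ∷ (κ′ , vs′) ∷ _ ; bads = b ∷ b′ ∷ _ ; apart = (ap ∷ _) ∷ _ } =
      ⊥-elim (ap (through κ vs b) (through κ′ vs′ b′))
    ... | record { size = k ; matching = M ; debts = [] ; bound = T≤ } = record
      { size = j + k ; matching = extend M ; debts = [] ; bads = [] ; apart = []
      ; bound = bound-step {X} {k} j 0 (+-monoˡ-≤ 0 (≤-trans (n≤1+n _) X≤)) T≤ }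
    ... | record { size = k ; matching = M ; debts = (κ , vs) ∷ [] ; bads = b ∷ [] ; bound = T≤ } = record
      { size = j + k ; matching = extend M ; debts = [] ; bads = [] ; apart = []
      ; bound = bound-step {X} {k} j 0 (one κ b) T≤ }
      where
      one : ∀ κ {vs} → Bad κ (S ∖ X) vs → length X + (cost κ + 0) ≤ 4 * j + 0
      one κ b = subst₂ _≤_ (trans (+-comm 1 (length X)) (cong (length X +_) (sym (cost≡1 κ b)))) (sym (+-identityʳ (4 * j))) X≤
        where
        cost≡1 : ∀ κ {vs} → Bad κ (S ∖ X) vs → cost κ + 0 ≡ 1
        cost≡1 point _ = refl
        cost≡1 theta _ = refl
        cost≡1 k4+   _ = refl
        cost≡1 k33   b = ⊥-elim (k33∉ noBad b)

  -- Recognising copies from a few edges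

  unique⇒injective : ∀ {k} (vs : Vec (Fin n) k) → Unique (toList vs) →
    ∀ i j → lookup vs i ≡ lookup vs j → i ≡ j
  unique⇒injective (v ∷ vs) _           0F      0F      _  = refl
  unique⇒injective (v ∷ vs) (v≢ ∷ _)    0F      (suc j) eq = ⊥-elim (All.lookup v≢ (lookup∈ vs j) eq)
  unique⇒injective (v ∷ vs) (v≢ ∷ _)    (suc i) 0F      eq = ⊥-elim (All.lookup v≢ (lookup∈ vs i) (sym eq))
  unique⇒injective (v ∷ vs) (_ ∷ vs!)   (suc i) (suc j) eq = cong suc (unique⇒injective vs vs! i j eq)

  -- Covers the entries above the diagonal only; `fullTable` obtains the others from symmetry and
  -- irreflexivity.
  UpperTable : ∀ {k} → Vec (Fin n) k → (Fin k → Fin k → Bool) → Set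
  UpperTable []       h = ⊤
  UpperTable (v ∷ vs) h = (∀ j → adj G v (lookup vs j) ≡ h 0F (suc j)) × UpperTable vs (λ i j → h (suc i) (suc j))

  fullTable : ∀ {k} (vs : Vec (Fin n) k) {h} → (∀ i j → h i j ≡ h j i) → (∀ i → h i i ≡ false) →
    UpperTable vs h → ∀ i j → adj G (lookup vs i) (lookup vs j) ≡ h i j
  fullTable (v ∷ vs) h-sym h-irr _         0F      0F      = trans (irrefl G v) (sym (h-irr 0F))
  fullTable (v ∷ vs) h-sym h-irr (row , _) 0F      (suc j) = row j
  fullTable (v ∷ vs) h-sym h-irr (row , _) (suc i) 0F      =
    trans (adj-sym G _ v) (trans (row i) (h-sym 0F (suc i)))
  fullTable (v ∷ vs) h-sym h-irr (_ , tab) (suc i) (suc j) =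
    fullTable vs (λ i j → h-sym (suc i) (suc j)) (λ i → h-irr (suc i)) tab i j

  edgeIn-sym : ∀ es a b → edgeIn es a b ≡ edgeIn es b a
  edgeIn-sym [] a b = refl
  edgeIn-sym ((x , y) ∷ es) a b = begin
    (ab ∨ ba ∨ edgeIn es a b)    ≡⟨ Bool.∨-assoc ab ba _ ⟨
    ((ab ∨ ba) ∨ edgeIn es a b)  ≡⟨ cong₂ _∨_ (Bool.∨-comm ab ba) (edgeIn-sym es a b) ⟩
    ((ba ∨ ab) ∨ edgeIn es b a)  ≡⟨ Bool.∨-assoc ba ab _ ⟩
    (ba ∨ ab ∨ edgeIn es b a)    ∎
    where
    open ≡-Reasoning
    ab = (x ≡ᵇ a) ∧ (y ≡ᵇ b)
    ba = (x ≡ᵇ b) ∧ (y ≡ᵇ a)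

  shape-sym : ∀ κ i j → shape κ i j ≡ shape κ j i
  shape-sym κ i j = edgeIn-sym (shapeEdges κ) (toℕ i) (toℕ j)

  shape-irrefl : ∀ κ i → shape κ i i ≡ false
  shape-irrefl point 0F = refl
  shape-irrefl theta = λ { 0F → refl ; 1F → refl ; 2F → refl ; 3F → refl ; 4F → refl }
  shape-irrefl k4+   = λ { 0F → refl ; 1F → refl ; 2F → refl ; 3F → refl ; 4F → refl }
  shape-irrefl k33   = λ { 0F → refl ; 1F → refl ; 2F → refl ; 3F → refl ; 4F → refl ; 5F → refl }

  make-copy : ∀ κ {S} vs → Unique (toList vs) → All (_∈ S) (toList vs) → UpperTable vs (shape κ) → Copy κ S vs
  make-copy κ vs vs! vs∈ tab = record
    { injective = unique⇒injective vs vs!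
    ; member    = λ i → All.lookup vs∈ (lookup∈ vs i)
    ; adjacency = fullTable vs (shape-sym κ) (shape-irrefl κ) tab
    }

  -- Non-edges at a vertex of known degree three come for free. Of the constructions below only K₂,₃
  -- has to ask for non-edges, namely those between its legs.
  full : ∀ {v a b c w} → v ~ a → v ~ b → v ~ c → Unique (w ∷ a ∷ b ∷ c ∷ []) → adj G v w ≡ false
  full v~a v~b v~c (w≢ ∷ (a≢b ∷ a≢c ∷ []) ∷ (b≢c ∷ []) ∷ _) =
    ≁⇒false λ v~w → All.lookup w≢ (saturated v~a v~b v~c a≢b a≢c b≢c v~w) refl

  theta-copy : ∀ {S p q a b c} → All (_∈ S) (p ∷ q ∷ a ∷ b ∷ c ∷ []) →
    p ≢ q → a ≢ b → a ≢ c → b ≢ c →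
    p ~ a → p ~ b → p ~ c → q ~ a → q ~ b → q ~ c →
    ¬ a ~ b → ¬ a ~ c → ¬ b ~ c → Copy theta S (p ∷ q ∷ a ∷ b ∷ c ∷ [])
  theta-copy vs∈ p≢q a≢b a≢c b≢c pa pb pc qa qb qc a≁b a≁c b≁c = make-copy theta _
    ((p≢q ∷ ~⇒≢ pa ∷ ~⇒≢ pb ∷ ~⇒≢ pc ∷ []) ∷ (~⇒≢ qa ∷ ~⇒≢ qb ∷ ~⇒≢ qc ∷ []) ∷ unique3 a≢b a≢c b≢c)
    vs∈
    ( (λ { 0F → full pa pb pc ((~⇒≢ qa ∷ ~⇒≢ qb ∷ ~⇒≢ qc ∷ []) ∷ unique3 a≢b a≢c b≢c)
         ; 1F → pa ; 2F → pb ; 3F → pc })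
    , (λ { 0F → qa ; 1F → qb ; 2F → qc })
    , (λ { 0F → ≁⇒false a≁b ; 1F → ≁⇒false a≁c })
    , (λ { 0F → ≁⇒false b≁c })
    , (λ ()) , tt )

  k4+-copy : ∀ {S a b c d z} → All (_∈ S) (a ∷ b ∷ c ∷ d ∷ z ∷ []) →
    a ≢ b → c ≢ z → d ≢ z → a ~ c → a ~ d → b ~ c → b ~ d → c ~ d → a ~ z → b ~ z →
    Copy k4+ S (a ∷ b ∷ c ∷ d ∷ z ∷ [])
  k4+-copy vs∈ a≢b c≢z d≢z ac ad bc bd cd az bz = make-copy k4+ _
    ((a≢b ∷ a≢c ∷ a≢d ∷ a≢z ∷ []) ∷ (b≢c ∷ b≢d ∷ b≢z ∷ []) ∷ (c≢d ∷ c≢z ∷ []) ∷ (d≢z ∷ []) ∷ [] ∷ [])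
    vs∈
    ( (λ { 0F → full ac ad az ((b≢c ∷ b≢d ∷ b≢z ∷ []) ∷ unique3 c≢d c≢z d≢z) ; 1F → ac ; 2F → ad ; 3F → az })
    , (λ { 0F → bc ; 1F → bd ; 2F → bz })
    , (λ { 0F → cd ; 1F → full (~-sym ac) (~-sym bc) cd
             ((≢-sym a≢z ∷ ≢-sym b≢z ∷ ≢-sym d≢z ∷ []) ∷ unique3 a≢b a≢d b≢d) })
    , (λ { 0F → full (~-sym ad) (~-sym bd) (~-sym cd)
             ((≢-sym a≢z ∷ ≢-sym b≢z ∷ ≢-sym c≢z ∷ []) ∷ unique3 a≢b a≢c b≢c) })
    , (λ ()) , tt )
    where
    a≢c = ~⇒≢ ac
    a≢d = ~⇒≢ ad
    b≢c = ~⇒≢ bc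
    b≢d = ~⇒≢ bd
    c≢d = ~⇒≢ cd
    a≢z = ~⇒≢ az
    b≢z = ~⇒≢ bz

  k33-copy : ∀ {S p q r a b c} → All (_∈ S) (p ∷ q ∷ r ∷ a ∷ b ∷ c ∷ []) →
    p ≢ q → p ≢ r → q ≢ r → a ≢ b → a ≢ c → b ≢ c →
    p ~ a → p ~ b → p ~ c → q ~ a → q ~ b → q ~ c → r ~ a → r ~ b → r ~ c →
    Copy k33 S (p ∷ q ∷ r ∷ a ∷ b ∷ c ∷ [])
  k33-copy {p = p} {q} {r} {a} {b} {c} vs∈ p≢q p≢r q≢r a≢b a≢c b≢c pa pb pc qa qb qc ra rb rc = make-copy k33 _
    ((p≢q ∷ p≢r ∷ p≢) ∷ (q≢r ∷ q≢) ∷ r≢ ∷ legs)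
    vs∈
    ( (λ { 0F → full pa pb pc (q≢ ∷ legs) ; 1F → full pa pb pc (r≢ ∷ legs) ; 2F → pa ; 3F → pb ; 4F → pc })
    , (λ { 0F → full qa qb qc (r≢ ∷ legs) ; 1F → qa ; 2F → qb ; 3F → qc })
    , (λ { 0F → ra ; 1F → rb ; 2F → rc })
    , (λ { 0F → full (~-sym pa) (~-sym qa) (~-sym ra) ((~⇒≢ (~-sym pb) ∷ ~⇒≢ (~-sym qb) ∷ ~⇒≢ (~-sym rb) ∷ []) ∷ hubs)
         ; 1F → full (~-sym pa) (~-sym qa) (~-sym ra) ((~⇒≢ (~-sym pc) ∷ ~⇒≢ (~-sym qc) ∷ ~⇒≢ (~-sym rc) ∷ []) ∷ hubs) })
    , (λ { 0F → full (~-sym pb) (~-sym qb) (~-sym rb) ((~⇒≢ (~-sym pc) ∷ ~⇒≢ (~-sym qc) ∷ ~⇒≢ (~-sym rc) ∷ []) ∷ hubs) })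
    , (λ ()) , tt )
    where
    legs : Unique (a ∷ b ∷ c ∷ [])
    legs = unique3 a≢b a≢c b≢c
    hubs : Unique (p ∷ q ∷ r ∷ [])
    hubs = unique3 p≢q p≢r q≢r
    p≢ : All (p ≢_) (a ∷ b ∷ c ∷ [])
    p≢ = ~⇒≢ pa ∷ ~⇒≢ pb ∷ ~⇒≢ pc ∷ []
    q≢ : All (q ≢_) (a ∷ b ∷ c ∷ [])
    q≢ = ~⇒≢ qa ∷ ~⇒≢ qb ∷ ~⇒≢ qc ∷ []
    r≢ : All (r ≢_) (a ∷ b ∷ c ∷ [])
    r≢ = ~⇒≢ ra ∷ ~⇒≢ rb ∷ ~⇒≢ rc ∷ []

  -- Together with `exchange` this generates all permutations of the legs, so later statements can
  -- fix the position of a leg.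
  rotate : ∀ {S p q a b c} → Copy theta S (p ∷ q ∷ a ∷ b ∷ c ∷ []) → Copy theta S (p ∷ q ∷ b ∷ c ∷ a ∷ [])
  rotate t = theta-copy
    (member t 0F ∷ member t 1F ∷ member t 3F ∷ member t 4F ∷ member t 2F ∷ [])
    (distinct t 0F 1F (λ ())) (distinct t 3F 4F (λ ())) (distinct t 3F 2F (λ ())) (distinct t 4F 2F (λ ()))
    (edge t 0F 3F refl) (edge t 0F 4F refl) (edge t 0F 2F refl)
    (edge t 1F 3F refl) (edge t 1F 4F refl) (edge t 1F 2F refl)
    (no-edge t 3F 4F refl) (no-edge t 3F 2F refl) (no-edge t 4F 2F refl)

  -- Adding one or two edges across a deletion

  ∈[]-elim : {A : Set} {v : Fin n} → v ∈ [] → A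
  ∈[]-elim ()

  alive⇒∉ : ∀ {S X v} → v ∈ S ∖ X → v ∉ X
  alive⇒∉ v∈ = proj₂ (∖⁻ v∈)

  removed : ∀ {S X v} → v ∈ X → v ∉ S ∖ X
  removed v∈X v∈ = alive⇒∉ v∈ v∈X

  one-edge : ∀ {S X u v} t → u ∈ S → v ∈ S → u ∈ X → v ∈ X → u ~ v →
    Neighbours⊆ (S ∖ X) u [] → Neighbours⊆ (S ∖ X) v (t ∷ []) →
    ∀ {k} → AcyclicMatching (S ∖ X) k → AcyclicMatching S (1 + k)
  one-edge t u∈S v∈S u∈X v∈X u~v nu nv = match t ∖-⊆ u∈S v∈S (removed u∈X) (removed v∈X) u~v nu nv

  -- Adds the path u v v′ u′, where u may have a neighbour t left over and the other three may not.
  path-edges : ∀ {S X u v u′ v′} t → All (_∈ S) (u ∷ v ∷ v′ ∷ u′ ∷ []) → All (_∈ X) (u ∷ v ∷ v′ ∷ u′ ∷ []) →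
    v ~ u → u′ ~ v′ → ¬ u′ ~ u → ¬ u′ ~ v → ¬ v′ ~ u → u′ ≢ u → u′ ≢ v → v′ ≢ u → v′ ≢ v →
    Neighbours⊆ (S ∖ X) u (t ∷ []) → Neighbours⊆ (S ∖ X) v [] →
    Neighbours⊆ (S ∖ X) v′ [] → Neighbours⊆ (S ∖ X) u′ [] →
    ∀ {k} → AcyclicMatching (S ∖ X) k → AcyclicMatching S (2 + k)
  path-edges {S} {X} {u} {v} {u′} {v′} t (u∈S ∷ v∈S ∷ v′∈S ∷ u′∈S ∷ []) (u∈X ∷ v∈X ∷ v′∈X ∷ u′∈X ∷ [])
    v~u u′~v′ u′≁u u′≁v v′≁u u′≢u u′≢v v′≢u v′≢v nu nv nv′ nu′ M =
    match v inS u′∈S v′∈S (∉-∷ u′≢v (∉-∷ u′≢u (removed u′∈X))) (∉-∷ v′≢v (∉-∷ v′≢u (removed v′∈X))) u′~v′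
      (λ { at0 e → ⊥-elim (u′≁v e) ; at1 e → ⊥-elim (u′≁u e) ; (there (there w∈)) e → nu′ w∈ e })
      (λ { at0 _ → at0 ; at1 e → ⊥-elim (v′≁u e) ; (there (there w∈)) e → ∈[]-elim (nv′ w∈ e) })
      (match t (there ∘ there) at0 at1 (removed v∈X) (removed u∈X) v~u nv nu M)
    where
    inS : v ∷ u ∷ S ∖ X ⊆ S
    inS at0                = v∈S
    inS at1                = u∈S
    inS (there (there w∈)) = ∖-⊆ w∈

  -- Free and attached legs of K₂,₃

  Leg : List (Fin n) → Fin n → Fin n → Fin n → Set
  Leg S p q a = Neighbours⊆ S a (p ∷ q ∷ [])

  bad-legs : ∀ {T p q a b c} → Bad theta T (p ∷ q ∷ a ∷ b ∷ c ∷ []) → Leg T p q a × Leg T p q b × Leg T p q c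
  bad-legs {T} {p} {q} {a} {b} {c} t = leg 2F refl refl refl , leg 3F refl refl refl , leg 4F refl refl refl
    where
    vs = p ∷ q ∷ a ∷ b ∷ c ∷ []
    leg : ∀ i → shape theta i 2F ≡ false → shape theta i 3F ≡ false → shape theta i 4F ≡ false →
      Leg T p q (lookup vs i)
    leg i ia ib ic w∈ i~w with closed t i w∈ i~w
    ... | at0 = at0
    ... | at1 = at1
    ... | at2 = ⊥-elim (no-edge (copy t) i 2F ia i~w)
    ... | at3 = ⊥-elim (no-edge (copy t) i 3F ib i~w)
    ... | at4 = ⊥-elim (no-edge (copy t) i 4F ic i~w)

  module _ {S p q a b c} (t : Copy theta S (p ∷ q ∷ a ∷ b ∷ c ∷ [])) where

    hub₁ : ∀ {w} → p ~ w → w ∈ a ∷ b ∷ c ∷ []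
    hub₁ = saturated (edge t 0F 2F refl) (edge t 0F 3F refl) (edge t 0F 4F refl)
      (distinct t 2F 3F (λ ())) (distinct t 2F 4F (λ ())) (distinct t 3F 4F (λ ()))

    hub₂ : ∀ {w} → q ~ w → w ∈ a ∷ b ∷ c ∷ []
    hub₂ = saturated (edge t 1F 2F refl) (edge t 1F 3F refl) (edge t 1F 4F refl)
      (distinct t 2F 3F (λ ())) (distinct t 2F 4F (λ ())) (distinct t 3F 4F (λ ()))

    -- The hubs are saturated by the legs, so an edge leaving the copy could only start at a leg.
    free-legs⇒bad : Leg S p q a → Leg S p q b → Leg S p q c → Bad theta S (p ∷ q ∷ a ∷ b ∷ c ∷ [])
    free-legs⇒bad fa fb fc = record { copy = t ; closed = λ
      { 0F _ e → there (there (hub₁ e)) ; 1F _ e → there (there (hub₂ e))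
      ; 2F w∈ e → widen (fa w∈ e) ; 3F w∈ e → widen (fb w∈ e) ; 4F w∈ e → widen (fc w∈ e) } }
      where
      widen : ∀ {w} → w ∈ p ∷ q ∷ [] → w ∈ p ∷ q ∷ a ∷ b ∷ c ∷ []
      widen = ∈-++⁺ˡ

    module _ {x} (a~x : a ~ x) (x∉ : x ∉ p ∷ q ∷ []) where

      leg-full : ∀ {w} → a ~ w → w ∈ p ∷ q ∷ x ∷ []
      leg-full = saturated (edge t 2F 0F refl) (edge t 2F 1F refl) a~x (distinct t 0F 1F (λ ()))
        (λ { refl → x∉ at0 }) (λ { refl → x∉ at1 })

      leg-exit : x ∉ p ∷ q ∷ a ∷ b ∷ c ∷ []
      leg-exit at0 = x∉ at0
      leg-exit at1 = x∉ at1
      leg-exit at2 = ~⇒≢ a~x refl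
      leg-exit at3 = no-edge t 2F 3F refl a~x
      leg-exit at4 = no-edge t 2F 4F refl a~x

  -- Pendant K₄⁺ and K₂,₃ with a free leg

  module Pendant {S} (S! : Unique S) (solve : ∀ T → Unique T → length T < length S → Solution T)
    (noBad : NoBad S) where

    open Reduce S! solve

    module PendantK4+ {a b c d z} (t : Copy k4+ S (a ∷ b ∷ c ∷ d ∷ z ∷ [])) where

      na : ∀ {w} → a ~ w → w ∈ c ∷ d ∷ z ∷ []
      na = saturated (edge t 0F 2F refl) (edge t 0F 3F refl) (edge t 0F 4F refl)
        (distinct t 2F 3F (λ ())) (distinct t 2F 4F (λ ())) (distinct t 3F 4F (λ ()))

      nb : ∀ {w} → b ~ w → w ∈ c ∷ d ∷ z ∷ []
      nb = saturated (edge t 1F 2F refl) (edge t 1F 3F refl) (edge t 1F 4F refl)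
        (distinct t 2F 3F (λ ())) (distinct t 2F 4F (λ ())) (distinct t 3F 4F (λ ()))

      nc : ∀ {w} → c ~ w → w ∈ a ∷ b ∷ d ∷ []
      nc = saturated (edge t 2F 0F refl) (edge t 2F 1F refl) (edge t 2F 3F refl)
        (distinct t 0F 1F (λ ())) (distinct t 0F 3F (λ ())) (distinct t 1F 3F (λ ()))

      nd : ∀ {w} → d ~ w → w ∈ a ∷ b ∷ c ∷ []
      nd = saturated (edge t 3F 0F refl) (edge t 3F 1F refl) (edge t 3F 2F refl)
        (distinct t 0F 1F (λ ())) (distinct t 0F 2F (λ ())) (distinct t 1F 2F (λ ()))

      solution : Solution S
      solution with beyond? S z (a ∷ b ∷ [])
      ... | inj₂ nz = ⊥-elim (noBad k4+ _ record { copy = t ; closed = λ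
        { 0F _ e → case na e of λ { at0 → at2 ; at1 → at3 ; at2 → at4 }
        ; 1F _ e → case nb e of λ { at0 → at2 ; at1 → at3 ; at2 → at4 }
        ; 2F _ e → case nc e of λ { at0 → at0 ; at1 → at1 ; at2 → at3 }
        ; 3F _ e → case nd e of λ { at0 → at0 ; at1 → at1 ; at2 → at2 }
        ; 4F w∈ e → case nz w∈ e of λ { at0 → at0 ; at1 → at1 } } })
      ... | inj₁ (x , x∈S , z~x , x∉) =
        -- Only the subdividing vertex `z` has a degree to spare. The other four vertices are traded
        -- for the edge `c a`, and `z` stays behind as a leaf at `x`, hence in no bad piece.
        reduce₀ X 1 (member t 0F) at0
          (noBad-leaf noBad frontier (∖⁺ x∈S x∉X) z~x (λ w∈ e → ∈-skip (alive⇒∉ w∈) at1 (∈-skip (alive⇒∉ w∈) at0 (nz e))))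
          ≤-refl
          (one-edge z (member t 2F) (member t 0F) at2 at0 (edge t 2F 0F refl)
            (λ w∈ e → ∈-skip (alive⇒∉ w∈) at3 (∈-skip (alive⇒∉ w∈) at1 (∈-skip (alive⇒∉ w∈) at0 (nc e))))
            (λ w∈ e → ∈-skip (alive⇒∉ w∈) at3 (∈-skip (alive⇒∉ w∈) at2 (na e))))
        where
        X = a ∷ b ∷ c ∷ d ∷ []
        nz : ∀ {w} → z ~ w → w ∈ a ∷ b ∷ x ∷ []
        nz = saturated (edge t 4F 0F refl) (edge t 4F 1F refl) z~x (distinct t 0F 1F (λ ()))
          (λ { refl → x∉ at0 }) (λ { refl → x∉ at1 })
        x∉X : x ∉ X
        x∉X at0 = x∉ at0
        x∉X at1 = x∉ at1
        x∉X at2 = no-edge t 4F 2F refl z~x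
        x∉X at3 = no-edge t 4F 3F refl z~x
        frontier : Frontier S X (z ∷ [])
        frontier _ b∉ at0 e = ∈-skip b∉ at3 (∈-skip b∉ at2 (na (~-sym e)))
        frontier _ b∉ at1 e = ∈-skip b∉ at3 (∈-skip b∉ at2 (nb (~-sym e)))
        frontier _ b∉ at2 e = ∈[]-elim (∈-skip b∉ at3 (∈-skip b∉ at1 (∈-skip b∉ at0 (nc (~-sym e)))))
        frontier _ b∉ at3 e = ∈[]-elim (∈-skip b∉ at2 (∈-skip b∉ at1 (∈-skip b∉ at0 (nd (~-sym e)))))

    pendant-theta : ∀ {p q a b c} → Copy theta S (p ∷ q ∷ a ∷ b ∷ c ∷ []) → Leg S p q b → Leg S p q c → Solution S
    pendant-theta {p} {q} {a} {b} {c} t fb fc with beyond? S a (p ∷ q ∷ [])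
    ... | inj₂ fa = ⊥-elim (noBad theta _ (free-legs⇒bad t fa fb fc))
    ... | inj₁ (x , x∈S , a~x , x∉) =
      -- The hubs and the free legs are traded for the edge `b p`; the attached leg `a` stays behind
      -- as a leaf at `x`.
      reduce₀ X 1 (member t 0F) at0
        (noBad-leaf noBad frontier (∖⁺ x∈S x∉X) a~x
          (λ w∈ e → ∈-skip (alive⇒∉ w∈) at1 (∈-skip (alive⇒∉ w∈) at0 (leg-full t a~x x∉ e))))
        ≤-refl
        (one-edge a (member t 3F) (member t 0F) at2 at0 (edge t 3F 0F refl)
          (λ w∈ e → ∈-skip (alive⇒∉ w∈) at1 (∈-skip (alive⇒∉ w∈) at0 (fb (∖-⊆ w∈) e)))
          (λ w∈ e → frontier (∖-⊆ w∈) (alive⇒∉ w∈) at0 (~-sym e)))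
      where
      X = p ∷ q ∷ b ∷ c ∷ []
      x∉X : x ∉ X
      x∉X at0 = x∉ at0
      x∉X at1 = x∉ at1
      x∉X at2 = leg-exit t a~x x∉ at3
      x∉X at3 = leg-exit t a~x x∉ at4
      only-a : ∀ {w} → w ∉ X → w ∈ a ∷ b ∷ c ∷ [] → w ∈ a ∷ []
      only-a w∉ at0 = at0
      only-a w∉ at1 = ⊥-elim (w∉ at2)
      only-a w∉ at2 = ⊥-elim (w∉ at3)
      frontier : Frontier S X (a ∷ [])
      frontier _  w∉ at0 e = only-a w∉ (hub₁ t (~-sym e))
      frontier _  w∉ at1 e = only-a w∉ (hub₂ t (~-sym e))
      frontier w∈ w∉ at2 e = ∈[]-elim (∈-skip w∉ at1 (∈-skip w∉ at0 (fb w∈ (~-sym e))))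
      frontier w∈ w∉ at3 e = ∈[]-elim (∈-skip w∉ at1 (∈-skip w∉ at0 (fc w∈ (~-sym e))))

    module TwoAttached (noK4+ : ∀ vs → ¬ Copy k4+ S vs)
      (noPendant : ∀ {p q a b c} → Copy theta S (p ∷ q ∷ a ∷ b ∷ c ∷ []) → Leg S p q b → ¬ Leg S p q c)
      {p q a b c} (t : Copy theta S (p ∷ q ∷ a ∷ b ∷ c ∷ [])) (fc : Leg S p q c)
      {x} (x∈S : x ∈ S) (a~x : a ~ x) (x∉ : x ∉ p ∷ q ∷ [])
      {y} (y∈S : y ∈ S) (b~y : b ~ y) (y∉ : y ∉ p ∷ q ∷ []) where

      t′ = rotate t

      -- The whole copy is deleted together with the leaf `y`. The path `y b p c` supplies two edges
      -- for six vertices, and only `x` borders the rest, so seven units are charged against eight.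
      leaf-case : Neighbours⊆ S y (b ∷ []) → Solution S
      leaf-case ny = reduce₁ x X 2 (member t 0F) at1 noBad through (n≤1+n 7)
        (path-edges x (y∈S ∷ member t 3F ∷ member t 0F ∷ member t 4F ∷ []) (at3 ∷ at2 ∷ at1 ∷ at0 ∷ [])
          b~y (edge t 4F 0F refl)
          (λ c~y → y∉ (fc y∈S c~y)) (no-edge t 4F 3F refl) (λ p~y → leg-exit t′ b~y y∉ (there (there (hub₁ t′ p~y))))
          (λ { refl → leg-exit t′ b~y y∉ at3 }) (distinct t 4F 3F (λ ())) (λ { refl → y∉ at0 }) (distinct t 0F 3F (λ ()))
          (λ w∈ e → ∈[]-elim (∈-skip (alive⇒∉ w∈) at2 (ny (∖-⊆ w∈) e)))
          (λ w∈ e → ∈-skip (alive⇒∉ w∈) at3 (∈-skip (alive⇒∉ w∈) at4 (∈-skip (alive⇒∉ w∈) at1 (nb e))))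
          (λ w∈ e → ∈-skip (alive⇒∉ w∈) at0 (∈-skip (alive⇒∉ w∈) at2 (∈-skip (alive⇒∉ w∈) at5 (hub₁ t e))))
          (λ w∈ e → ∈-skip (alive⇒∉ w∈) at4 (∈-skip (alive⇒∉ w∈) at1 (fc (∖-⊆ w∈) e))))
        where
        X = c ∷ p ∷ b ∷ y ∷ q ∷ a ∷ []
        nb = leg-full t′ b~y y∉
        frontier : Frontier S X (x ∷ [])
        frontier w∈ w∉ at0 e = ∈[]-elim (∈-skip w∉ at4 (∈-skip w∉ at1 (fc w∈ (~-sym e))))
        frontier w∈ w∉ at1 e = ∈[]-elim (∈-skip w∉ at0 (∈-skip w∉ at2 (∈-skip w∉ at5 (hub₁ t (~-sym e)))))
        frontier w∈ w∉ at2 e = ∈[]-elim (∈-skip w∉ at3 (∈-skip w∉ at4 (∈-skip w∉ at1 (nb (~-sym e)))))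
        frontier w∈ w∉ at3 e = ∈[]-elim (∈-skip w∉ at2 (ny w∈ (~-sym e)))
        frontier w∈ w∉ at4 e = ∈[]-elim (∈-skip w∉ at0 (∈-skip w∉ at2 (∈-skip w∉ at5 (hub₂ t (~-sym e)))))
        frontier w∈ w∉ at5 e = ∈-skip w∉ at4 (∈-skip w∉ at1 (leg-full t a~x x∉ (~-sym e)))
        through : ∀ κ vs → Bad κ (S ∖ X) vs → x ∈ toList vs
        through κ vs b with attached∈ noBad frontier b
        ... | i , here refl = lookup∈ vs i

      -- Deleting `p`, `q`, `b`, `c` leaves only `a` and `y` on the boundary. As `a` becomes a leaf,
      -- anything bad contains `y`. The vertex `z` keeps `y` from being isolated, and a K₂,₃ through
      -- `y` would have two free legs in `S` or a hub at `y`.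
      non-leaf-case : ∀ {z} → z ∈ S → y ~ z → z ∉ b ∷ [] → Solution S
      non-leaf-case {z} z∈S y~z z∉ = reduce₀ X 1 (member t 0F) at0 noBad′ ≤-refl
        (one-edge a (member t 4F) (member t 0F) at3 at0 (edge t 4F 0F refl)
          (λ w∈ e → ∈-skip (alive⇒∉ w∈) at1 (∈-skip (alive⇒∉ w∈) at0 (fc (∖-⊆ w∈) e)))
          (λ w∈ e → only-a (alive⇒∉ w∈) (hub₁ t e)))
        where
        X = p ∷ q ∷ b ∷ c ∷ []
        only-a : ∀ {w} → w ∉ X → w ∈ a ∷ b ∷ c ∷ [] → w ∈ a ∷ []
        only-a w∉ at0 = at0
        only-a w∉ at1 = ⊥-elim (w∉ at2)
        only-a w∉ at2 = ⊥-elim (w∉ at3)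
        frontier : Frontier S X (a ∷ y ∷ [])
        frontier _  w∉ at0 e = ∈-++⁺ˡ (only-a w∉ (hub₁ t (~-sym e)))
        frontier _  w∉ at1 e = ∈-++⁺ˡ (only-a w∉ (hub₂ t (~-sym e)))
        frontier w∈ w∉ at2 e = there (∈-skip w∉ at1 (∈-skip w∉ at0 (leg-full t′ b~y y∉ (~-sym e))))
        frontier w∈ w∉ at3 e = ∈[]-elim (∈-skip w∉ at1 (∈-skip w∉ at0 (fc w∈ (~-sym e))))
        x∉X : x ∉ X
        x∉X at0 = x∉ at0
        x∉X at1 = x∉ at1
        x∉X at2 = leg-exit t a~x x∉ at3
        x∉X at3 = leg-exit t a~x x∉ at4
        a∉bad : ∀ {κ vs} i → Bad κ (S ∖ X) vs → lookup vs i ≢ a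
        a∉bad i b refl = leaf∉bad i b (∖⁺ x∈S x∉X) a~x
          (λ w∈ e → ∈-skip (alive⇒∉ w∈) at1 (∈-skip (alive⇒∉ w∈) at0 (leg-full t a~x x∉ e)))
        z∉X : z ∉ X
        z∉X at0 = leg-exit t′ b~y y∉ (there (there (hub₁ t′ (~-sym y~z))))
        z∉X at1 = leg-exit t′ b~y y∉ (there (there (hub₂ t′ (~-sym y~z))))
        z∉X at2 = z∉ at0
        z∉X at3 = y∉ (fc y∈S (~-sym y~z))

        -- Only the leg y of such a copy can be attached, so its other two legs are free in S.
        free : ∀ {p′ q′ vs} i j → Bad theta (S ∖ X) vs → lookup vs i ≡ y → i ≢ j →
          Leg (S ∖ X) p′ q′ (lookup vs j) → Leg S p′ q′ (lookup vs j)
        free i j bad refl i≢j leg {w} w∈ e with w ∈? X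
        ... | no  w∉ = leg (∖⁺ w∈ w∉) e
        ... | yes w∈X with frontier (bad∈ bad j) (bad∉ bad j) w∈X e
        ...   | here j≡a = ⊥-elim (a∉bad j bad j≡a)
        ...   | there (here j≡y) = ⊥-elim (distinct (copy bad) j i (≢-sym i≢j) j≡y)

        -- A hub is adjacent to its own legs only, and these survive the deletion; `y` is adjacent
        -- to the deleted `b`.
        hub-detached : ∀ {p′ a′ b′ c′} → p′ ≡ y → (∀ {w} → p′ ~ w → w ∈ a′ ∷ b′ ∷ c′ ∷ []) →
          All (_∉ X) (a′ ∷ b′ ∷ c′ ∷ []) → ⊥
        hub-detached refl np outside = All.lookup outside (np (~-sym b~y)) at2

        noBad′ : NoBad (S ∖ X)
        noBad′ κ vs bad with attached∈ noBad frontier bad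
        noBad′ κ vs bad | i , at0 = a∉bad i bad refl
        noBad′ point (_ ∷ []) bad | 0F , at1 with closed bad 0F (∖⁺ z∈S z∉X) y~z
        ... | at0 = ~⇒≢ y~z refl
        noBad′ k4+ vs bad | _ , at1 = noK4+ vs (copy-mono ∖-⊆ (copy bad))
        noBad′ k33 vs bad | _ , at1 = k33∉ noBad bad
        noBad′ theta (p′ ∷ q′ ∷ a′ ∷ b′ ∷ c′ ∷ []) bad | i , there (here i≡y) = at i i≡y
          where
          s = copy-mono ∖-⊆ (copy bad)
          la = proj₁ (bad-legs bad)
          lb = proj₁ (proj₂ (bad-legs bad))
          lc = proj₂ (proj₂ (bad-legs bad))
          legs∉ : All (_∉ X) (a′ ∷ b′ ∷ c′ ∷ [])
          legs∉ = bad∉ bad 2F ∷ bad∉ bad 3F ∷ bad∉ bad 4F ∷ []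
          at : ∀ i → lookup (p′ ∷ q′ ∷ a′ ∷ b′ ∷ c′ ∷ []) i ≡ y → ⊥
          at 0F eq = hub-detached eq (hub₁ (copy bad)) legs∉
          at 1F eq = hub-detached eq (hub₂ (copy bad)) legs∉
          at 2F eq = noPendant s (free 2F 3F bad eq (λ ()) lb) (free 2F 4F bad eq (λ ()) lc)
          at 3F eq = noPendant (rotate s) (free 3F 4F bad eq (λ ()) lc) (free 3F 2F bad eq (λ ()) la)
          at 4F eq = noPendant (rotate (rotate s)) (free 4F 2F bad eq (λ ()) la) (free 4F 3F bad eq (λ ()) lb)

      solution : Solution S
      solution with beyond? S y (b ∷ [])
      ... | inj₂ ny = leaf-case ny
      ... | inj₁ (z , z∈S , y~z , z∉) = non-leaf-case z∈S y~z z∉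

  -- Rearranging the legs of K₂,₃

  ⊆-reverse : ∀ {xs ys : List (Fin n)} → Unique xs → xs ⊆ ys → length ys ≤ length xs → ys ⊆ xs
  ⊆-reverse {xs} {ys} xs! xs⊆ys ys≤xs {y} y∈ys with y ∈? xs
  ... | yes y∈xs = y∈xs
  ... | no  y∉xs = ⊥-elim (<-irrefl refl (≤-trans (⊆-length (¬Any⇒All¬ _ y∉xs ∷ xs!) y∷xs⊆ys) ys≤xs))
    where
    y∷xs⊆ys : y ∷ xs ⊆ ys
    y∷xs⊆ys at0        = y∈ys
    y∷xs⊆ys (there x∈) = xs⊆ys x∈

  exchange : ∀ {S p q a b c} → Copy theta S (p ∷ q ∷ a ∷ b ∷ c ∷ []) → Copy theta S (p ∷ q ∷ b ∷ a ∷ c ∷ [])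
  exchange t = theta-copy
    (member t 0F ∷ member t 1F ∷ member t 3F ∷ member t 2F ∷ member t 4F ∷ [])
    (distinct t 0F 1F (λ ())) (distinct t 3F 2F (λ ())) (distinct t 3F 4F (λ ())) (distinct t 2F 4F (λ ()))
    (edge t 0F 3F refl) (edge t 0F 2F refl) (edge t 0F 4F refl)
    (edge t 1F 3F refl) (edge t 1F 2F refl) (edge t 1F 4F refl)
    (no-edge t 3F 2F refl) (no-edge t 3F 4F refl) (no-edge t 2F 4F refl)

  BadTheta : List (Fin n) → (p q a b c : Fin n) → Set
  BadTheta T p q a b c = Bad theta T (p ∷ q ∷ a ∷ b ∷ c ∷ [])

  module _ {T p q a b c} (t : BadTheta T p q a b c) where

    rotate-bad : BadTheta T p q b c a
    rotate-bad with bad-legs t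
    ... | la , lb , lc = free-legs⇒bad (rotate (copy t)) lb lc la

    exchange-bad : BadTheta T p q b a c
    exchange-bad with bad-legs t
    ... | la , lb , lc = free-legs⇒bad (exchange (copy t)) lb la lc

    legs-unique : Unique (a ∷ b ∷ c ∷ [])
    legs-unique = unique3 (distinct (copy t) 2F 3F (λ ())) (distinct (copy t) 2F 4F (λ ())) (distinct (copy t) 3F 4F (λ ()))

  arrange : ∀ {T p q a b c v w} → BadTheta T p q a b c → v ∈ a ∷ b ∷ c ∷ [] → w ∈ a ∷ b ∷ c ∷ [] → v ≢ w →
    ∃ λ l → BadTheta T p q v w l
  arrange t at0 at0 v≢w = ⊥-elim (v≢w refl)
  arrange t at0 at1 _   = _ , t
  arrange t at0 at2 _   = _ , exchange-bad (rotate-bad (rotate-bad t))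
  arrange t at1 at0 _   = _ , exchange-bad t
  arrange t at1 at1 v≢w = ⊥-elim (v≢w refl)
  arrange t at1 at2 _   = _ , rotate-bad t
  arrange t at2 at0 _   = _ , rotate-bad (rotate-bad t)
  arrange t at2 at1 _   = _ , exchange-bad (rotate-bad t)
  arrange t at2 at2 v≢w = ⊥-elim (v≢w refl)

  -- Clean sets and what a deletion can leave behind

  record Clean (S : List (Fin n)) : Set where
    field
      noBad     : NoBad S
      noK4+     : ∀ vs → ¬ Copy k4+ S vs
      noFreeLeg : ∀ {p q a b c} → Copy theta S (p ∷ q ∷ a ∷ b ∷ c ∷ []) → ¬ Leg S p q c

  data View (S X : List (Fin n)) : ∀ κ → Vec (Fin n) (order κ) → Set where
    isolated : ∀ {b} → b ∈ S → b ∉ X → Neighbours⊆ S b X → View S X point (b ∷ [])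
    attached-theta : ∀ {p q a b c} → BadTheta (S ∖ X) p q a b c → View S X theta (p ∷ q ∷ a ∷ b ∷ c ∷ [])

  module Cleaned {S} (clean : Clean S) where

    open Clean clean public

    view : ∀ {X κ vs} → Bad κ (S ∖ X) vs → View S X κ vs
    view {X} {point} {b ∷ []} bad = isolated (bad∈ bad 0F) (bad∉ bad 0F) nb
      where
      nb : Neighbours⊆ S b X
      nb {w} w∈S b~w with w ∈? X
      ... | yes w∈X = w∈X
      ... | no  w∉X with closed bad 0F (∖⁺ w∈S w∉X) b~w
      ...   | at0 = ⊥-elim (~⇒≢ b~w refl)
    view {κ = theta} {_ ∷ _ ∷ _ ∷ _ ∷ _ ∷ []} bad = attached-theta bad
    view {κ = k4+} bad = ⊥-elim (noK4+ _ (copy-mono ∖-⊆ (copy bad)))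
    view {κ = k33} bad = ⊥-elim (k33∉ noBad bad)

    -- In `S` the leg has a neighbour other than the hubs, while in the closed piece it has none; so
    -- that neighbour was deleted.
    touch : ∀ {X p q a b c} → BadTheta (S ∖ X) p q a b c → ∃ λ x → x ∈ X × x ∈ S × c ~ x
    touch {X} {p} {q} {c = c} t with beyond? S c (p ∷ q ∷ [])
    ... | inj₂ free = ⊥-elim (noFreeLeg (copy-mono ∖-⊆ (copy t)) free)
    ... | inj₁ (x , x∈S , c~x , x∉) with x ∈? X
    ...   | yes x∈X = x , x∈X , x∈S , c~x
    ...   | no  x∉X = ⊥-elim (x∉ (proj₂ (proj₂ (bad-legs t)) (∖⁺ x∈S x∉X) c~x))

    legs⊆ : ∀ {X O p q a b c} → Frontier S X O → BadTheta (S ∖ X) p q a b c → a ∷ b ∷ c ∷ [] ⊆ O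
    legs⊆ {X} {O} frontier t = λ { at0 → last (rotate-bad t) ; at1 → last (rotate-bad (rotate-bad t)) ; at2 → last t }
      where
      last : ∀ {p q a b c} → BadTheta (S ∖ X) p q a b c → c ∈ O
      last t with touch t
      ... | x , x∈X , _ , c~x = frontier (bad∈ t 4F) (bad∉ t 4F) x∈X c~x

    -- Three distinct legs in a list of three entries fill it. Hence each listed vertex lies in
    -- every K₂,₃ that the deletion creates, which is what `reduce₁` asks for.
    all-legs : ∀ {X o₁ o₂ o₃ p q a b c} → Frontier S X (o₁ ∷ o₂ ∷ o₃ ∷ []) → BadTheta (S ∖ X) p q a b c →
      o₁ ∷ o₂ ∷ o₃ ∷ [] ⊆ a ∷ b ∷ c ∷ []
    all-legs frontier t = ⊆-reverse (legs-unique t) (legs⊆ frontier t) ≤-refl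

    neighbour : ∀ {v} → v ∈ S → ∃ λ w → w ∈ S × v ~ w
    neighbour {v} v∈S with beyond? S v []
    ... | inj₁ (w , w∈S , v~w , _) = w , w∈S , v~w
    ... | inj₂ none = ⊥-elim (noBad point (v ∷ []) record
      { copy   = make-copy point (v ∷ []) ([] ∷ []) (v∈S ∷ []) ((λ ()) , tt)
      ; closed = λ { 0F w∈S v~w → ∈[]-elim (none w∈S v~w) } })

  -- Leaves

  IsLeaf : List (Fin n) → Fin n → Fin n → Set
  IsLeaf S v u = u ∈ S × u ~ v × Neighbours⊆ S u (v ∷ [])

  isLeaf? : ∀ S v u → Dec (IsLeaf S v u)
  isLeaf? S v u = (u ∈? S) ×-dec (u ~? v) ×-dec neighbours⊆? S u (v ∷ [])

  module Leaves {S} (S! : Unique S) (solve : ∀ T → Unique T → length T < length S → Solution T)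
    (clean : Clean S) where

    open Reduce S! solve
    open Cleaned clean

    -- The star at `v` without `x` has three vertices and one usable edge, which leaves one unit for
    -- a bad piece at `x`.
    twin-leaves : ∀ {v u w} → v ∈ S → IsLeaf S v u → IsLeaf S v w → u ≢ w → Solution S
    twin-leaves {v} {u} {w} v∈S (u∈S , u~v , nu) (w∈S , w~v , nw) u≢w with third S (~-sym u~v) (~-sym w~v) u≢w
    ... | x , _ , _ , nv = reduce₁ x X 1 u∈S at0 noBad through ≤-refl
      (one-edge x u∈S v∈S at0 at1 u~v
        (λ z∈ e → ∈-skip (alive⇒∉ z∈) at1 (nu (∖-⊆ z∈) e))
        (λ z∈ e → ∈-skip (alive⇒∉ z∈) at2 (∈-skip (alive⇒∉ z∈) at0 (nv (∖-⊆ z∈) e))))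
      where
      X = u ∷ v ∷ w ∷ []
      frontier : Frontier S X (x ∷ [])
      frontier z∈ z∉ at0 e = ∈[]-elim (∈-skip z∉ at1 (nu z∈ (~-sym e)))
      frontier z∈ z∉ at1 e = ∈-skip z∉ at2 (∈-skip z∉ at0 (nv z∈ (~-sym e)))
      frontier z∈ z∉ at2 e = ∈[]-elim (∈-skip z∉ at1 (nw z∈ (~-sym e)))
      through : ∀ κ vs → Bad κ (S ∖ X) vs → x ∈ toList vs
      through κ vs b with attached∈ noBad frontier b
      ... | i , here refl = lookup∈ vs i

    leaf-at-degree≤2 : ∀ {v u w} → v ∈ S → IsLeaf S v u → Neighbours⊆ S v (u ∷ w ∷ []) → Solution S
    leaf-at-degree≤2 {v} {u} {w} v∈S (u∈S , u~v , nu) nv = reduce₁ w X 1 u∈S at0 noBad through (n≤1+n 3)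
      (one-edge w u∈S v∈S at0 at1 u~v
        (λ z∈ e → ∈-skip (alive⇒∉ z∈) at1 (nu (∖-⊆ z∈) e))
        (λ z∈ e → ∈-skip (alive⇒∉ z∈) at0 (nv (∖-⊆ z∈) e)))
      where
      X = u ∷ v ∷ []
      frontier : Frontier S X (w ∷ [])
      frontier z∈ z∉ at0 e = ∈[]-elim (∈-skip z∉ at1 (nu z∈ (~-sym e)))
      frontier z∈ z∉ at1 e = ∈-skip z∉ at0 (nv z∈ (~-sym e))
      through : ∀ κ vs → Bad κ (S ∖ X) vs → w ∈ toList vs
      through κ vs b with attached∈ noBad frontier b
      ... | i , here refl = lookup∈ vs i

    -- Trading `u`, `v`, `w` for the edge `u v` allows one bad piece. A created K₂,₃ contains the
    -- whole boundary, so the danger is two isolated vertices at once: `w′` and a leaf of `w`.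
    module AtCubic (noTwins : ∀ {v u w} → v ∈ S → IsLeaf S v u → IsLeaf S v w → ¬ u ≢ w)
      {v u w w′} (v∈S : v ∈ S) (leaf : IsLeaf S v u) (w∈S : w ∈ S) (w′∈S : w′ ∈ S) (v~w : v ~ w) (v~w′ : v ~ w′)
      (w≢u : w ≢ u) (w′≢u : w′ ≢ u) (w′≢w : w′ ≢ w) where

      u∈S = proj₁ leaf
      u~v = proj₁ (proj₂ leaf)
      nu  = proj₂ (proj₂ leaf)

      nv : ∀ {z} → v ~ z → z ∈ u ∷ w ∷ w′ ∷ []
      nv = saturated (~-sym u~v) v~w v~w′ (≢-sym w≢u) (≢-sym w′≢u) (≢-sym w′≢w)

      u~⇒v : ∀ {z} → z ∈ S → u ~ z → z ≡ v
      u~⇒v z∈S u~z with nu z∈S u~z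
      ... | at0 = refl

      non-leaf : ∀ {z} → z ∈ S → v ~ z → z ≢ u → Beyond S z (v ∷ [])
      non-leaf {z} z∈S v~z z≢u with beyond? S z (v ∷ [])
      ... | inj₁ b  = b
      ... | inj₂ nz = ⊥-elim (noTwins v∈S leaf (z∈S , ~-sym v~z , nz) (≢-sym z≢u))

      module _ {w₁ w₂} (nw : Neighbours⊆ S w (v ∷ w₁ ∷ w₂ ∷ [])) where

        X : List (Fin n)
        X = u ∷ v ∷ w ∷ []

        frontier : Frontier S X (w′ ∷ w₁ ∷ w₂ ∷ [])
        frontier z∈ z∉ at0 e = ∈[]-elim (∈-skip z∉ at1 (nu z∈ (~-sym e)))
        frontier z∈ z∉ at1 e with ∈-skip z∉ at2 (∈-skip z∉ at0 (nv (~-sym e)))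
        ... | at0 = at0
        frontier z∈ z∉ at2 e = there (∈-skip z∉ at1 (nw z∈ (~-sym e)))

        through : ∀ {o} → o ∈ w′ ∷ w₁ ∷ w₂ ∷ [] → (∀ {b} → b ∈ S → b ∉ X → Neighbours⊆ S b X → o ≡ b) →
          ∀ κ vs → Bad κ (S ∖ X) vs → o ∈ toList vs
        through o∈ alone κ vs bad with view bad
        ... | isolated b∈ b∉ nb = here (alone b∈ b∉ nb)
        ... | attached-theta t = there (there (all-legs frontier t o∈))

        reduce : ∀ {o} → o ∈ w′ ∷ w₁ ∷ w₂ ∷ [] → (∀ {b} → b ∈ S → b ∉ X → Neighbours⊆ S b X → o ≡ b) → Solution S
        reduce {o} o∈ alone = reduce₁ o X 1 u∈S at0 noBad (through o∈ alone) ≤-refl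
          (one-edge w′ u∈S v∈S at0 at1 u~v
            (λ z∈ e → ∈-skip (alive⇒∉ z∈) at1 (nu (∖-⊆ z∈) e))
            (λ z∈ e → ∈-skip (alive⇒∉ z∈) at2 (∈-skip (alive⇒∉ z∈) at0 (nv e))))

        isolated-cases : ∀ {b} → b ∈ S → b ∉ X → Neighbours⊆ S b X → b ≡ w′ ⊎ IsLeaf S w b
        isolated-cases {b} b∈ b∉ nb with b ~? v
        ... | yes b~v with ∈-skip b∉ at2 (∈-skip b∉ at0 (nv (~-sym b~v)))
        ...   | at0 = inj₁ refl
        isolated-cases {b} b∈ b∉ nb | no b≁v = inj₂ (b∈ , b~w , nb′)
          where
          nb′ : Neighbours⊆ S b (w ∷ [])
          nb′ z∈ e with nb z∈ e
          ... | at0 = ⊥-elim (b∉ (there (here (u~⇒v b∈ (~-sym e)))))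
          ... | at1 = ⊥-elim (b≁v e)
          ... | at2 = at0
          b~w : b ~ w
          b~w with neighbour b∈
          ... | z , z∈ , b~z with nb′ z∈ b~z
          ...   | at0 = b~z

        solution-no-leaf : (∀ z → ¬ IsLeaf S w z) → Solution S
        solution-no-leaf none = reduce at0 λ b∈ b∉ nb → case isolated-cases b∈ b∉ nb of λ
          { (inj₁ refl) → refl ; (inj₂ leaf) → ⊥-elim (none _ leaf) }

        module _ {z} (leaf′ : IsLeaf S w z) where

          z∈S = proj₁ leaf′
          z~w = proj₁ (proj₂ leaf′)
          nz  = proj₂ (proj₂ leaf′)

          z≢v : z ≢ v
          z≢v refl with nz u∈S (~-sym u~v)
          ... | at0 = w≢u refl

          z∈O : z ∈ w′ ∷ w₁ ∷ w₂ ∷ []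
          z∈O = there (∈-tail z≢v (nw z∈S (~-sym z~w)))

          -- The neighbour `y` keeps `w′` from being isolated, and without twin leaves `z` is the
          -- only vertex that can be; so `z` serves as the common vertex.
          open-case : Beyond S w′ (v ∷ w ∷ []) → Solution S
          open-case (y , y∈S , w′~y , y∉) = reduce z∈O alone
            where
            alone : ∀ {b} → b ∈ S → b ∉ X → Neighbours⊆ S b X → z ≡ b
            alone {b} b∈ b∉ nb with isolated-cases b∈ b∉ nb
            ... | inj₂ leaf″ with z ≟ b
            ...   | yes z≡b = z≡b
            ...   | no  z≢b = ⊥-elim (noTwins w∈S leaf′ leaf″ z≢b)
            alone {b} b∈ b∉ nb | inj₁ refl with nb y∈S w′~y
            ... | at0 = ⊥-elim (~⇒≢ v~w′ (sym (u~⇒v b∈ (~-sym w′~y))))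
            ... | there y∈ = ⊥-elim (y∉ y∈)

          -- Now `v`, `w`, `w′` form a triangle with the leaves `u` at `v` and `z` at `w`, and
          -- nothing else is attached. The path `u v w z` supplies two edges for these five
          -- vertices.
          closed-case : Neighbours⊆ S w′ (v ∷ w ∷ []) → Solution S
          closed-case nw′ = reduce₀ Y 2 u∈S at0 (noBad-sealed noBad frontier′) (m≤m+n 5 3)
            (path-edges v (u∈S ∷ v∈S ∷ w∈S ∷ z∈S ∷ []) (at0 ∷ at1 ∷ at2 ∷ at3 ∷ []) (~-sym u~v) z~w
              z≁u (λ z~v → z-only v∈S z~v (~⇒≢ v~w)) (λ w~u → ~⇒≢ v~w (sym (u~⇒v w∈S (~-sym w~u))))
              (λ { refl → ~⇒≢ v~w (sym (u~⇒v w∈S z~w)) }) z≢v w≢u (≢-sym (~⇒≢ v~w))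
              (λ x∈ e → ∈[]-elim (∈-skip (alive⇒∉ x∈) at1 (nu (∖-⊆ x∈) e)))
              (λ x∈ e → seal (∖-⊆ x∈) (alive⇒∉ x∈) at1 e)
              (λ x∈ e → seal (∖-⊆ x∈) (alive⇒∉ x∈) at2 e)
              (λ x∈ e → seal (∖-⊆ x∈) (alive⇒∉ x∈) at3 e))
            where
            Y : List (Fin n)
            Y = u ∷ v ∷ w ∷ z ∷ w′ ∷ []
            z-only : ∀ {x} → x ∈ S → z ~ x → x ≢ w → ⊥
            z-only x∈ e x≢w with nz x∈ e
            ... | at0 = x≢w refl
            z≁u : ¬ z ~ u
            z≁u z~u = z-only u∈S z~u (≢-sym w≢u)
            w~w′ : w ~ w′
            w~w′ with non-leaf w′∈S v~w′ w′≢u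
            ... | y , y∈S , w′~y , y∉ with nw′ y∈S w′~y
            ...   | at0 = ⊥-elim (y∉ at0)
            ...   | at1 = ~-sym w′~y
            z≢w′ : z ≢ w′
            z≢w′ refl = z-only v∈S (~-sym v~w′) (~⇒≢ v~w)
            seal : ∀ {x y} → x ∈ S → x ∉ Y → y ∈ Y → y ~ x → x ∈ []
            seal x∈ x∉ at0 e = ∈-skip x∉ at1 (nu x∈ e)
            seal x∈ x∉ at1 e = ∈-skip x∉ at4 (∈-skip x∉ at2 (∈-skip x∉ at0 (nv e)))
            seal x∈ x∉ at2 e = ∈-skip x∉ at4 (∈-skip x∉ at3 (∈-skip x∉ at1
              (saturated (~-sym v~w) (~-sym z~w) w~w′ (≢-sym z≢v) (~⇒≢ v~w′) z≢w′ e)))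
            seal x∈ x∉ at3 e = ∈-skip x∉ at2 (nz x∈ e)
            seal x∈ x∉ at4 e = ∈-skip x∉ at2 (∈-skip x∉ at1 (nw′ x∈ e))
            frontier′ : Frontier S Y []
            frontier′ x∈ x∉ y∈ e = seal x∈ x∉ y∈ (~-sym e)

          solution-leaf : Solution S
          solution-leaf with beyond? S w′ (v ∷ w ∷ [])
          ... | inj₁ b   = open-case b
          ... | inj₂ nw′ = closed-case nw′

      solution : Solution S
      solution with non-leaf w∈S v~w w≢u
      ... | w₁ , _ , w~w₁ , w₁∉ with third S (~-sym v~w) w~w₁ (λ { refl → w₁∉ at0 })
      ...   | w₂ , _ , _ , nw with Fin.any? (isLeaf? S w)
      ...     | yes (z , leaf′) = solution-leaf nw leaf′
      ...     | no none         = solution-no-leaf nw (λ z leaf′ → none (z , leaf′))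

    leaf-solution : ∀ {v u} → v ∈ S → IsLeaf S v u → Solution S
    leaf-solution {v} {u} v∈S leaf with Fin.any? (λ v → Fin.any? λ u → Fin.any? λ w →
      (v ∈? S) ×-dec isLeaf? S v u ×-dec isLeaf? S v w ×-dec ¬? (u ≟ w))
    ... | yes (v′ , u′ , w′ , v′∈S , l , l′ , u′≢w′) = twin-leaves v′∈S l l′ u′≢w′
    ... | no noTwins with beyond? S v (u ∷ [])
    -- Here `v` is a leaf as well; `u` is repeated to fill the second place of the list.
    ...   | inj₂ nv = leaf-at-degree≤2 {w = u} v∈S leaf (λ w∈ e → ∈-++⁺ˡ (nv w∈ e))
    ...   | inj₁ (w , w∈S , v~w , w∉) with beyond? S v (u ∷ w ∷ [])
    ...     | inj₂ nv = leaf-at-degree≤2 v∈S leaf nv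
    ...     | inj₁ (w′ , w′∈S , v~w′ , w′∉) = AtCubic.solution
      (λ v∈ l l′ u≢w → noTwins (_ , _ , _ , v∈ , l , l′ , u≢w)) v∈S leaf w∈S w′∈S v~w v~w′
      (λ { refl → w∉ at0 }) (λ { refl → w′∉ at0 }) (λ { refl → w′∉ at1 })

  -- Vertices of degree two

  theta-degree : ∀ {T p q a b c o v} → BadTheta T p q a b c → v ∈ a ∷ b ∷ c ∷ [] → ¬ Neighbours⊆ T v (o ∷ [])
  theta-degree {T} t = λ { at0 → last (rotate-bad t) ; at1 → last (rotate-bad (rotate-bad t)) ; at2 → last t }
    where
    last : ∀ {p q a b c o} → BadTheta T p q a b c → ¬ Neighbours⊆ T c (o ∷ [])
    last t nb with nb (member (copy t) 0F) (edge (copy t) 4F 0F refl) | nb (member (copy t) 1F) (edge (copy t) 4F 1F refl)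
    ... | at0 | here q≡p = distinct (copy t) 1F 0F (λ ()) q≡p

  few-legs : ∀ {T p q a b c o o′} → BadTheta T p q a b c → ¬ a ∷ b ∷ c ∷ [] ⊆ o ∷ o′ ∷ []
  few-legs t legs⊆ with ⊆-length (legs-unique t) legs⊆
  ... | s≤s (s≤s ())

  hub-degree : ∀ {T p q a b c h o o′} → BadTheta T p q a b c → h ∈ p ∷ q ∷ [] → ¬ Neighbours⊆ T h (o ∷ o′ ∷ [])
  hub-degree t at0 nb = few-legs t λ
    { at0 → nb (member (copy t) 2F) (edge (copy t) 0F 2F refl)
    ; at1 → nb (member (copy t) 3F) (edge (copy t) 0F 3F refl)
    ; at2 → nb (member (copy t) 4F) (edge (copy t) 0F 4F refl) }
  hub-degree t at1 nb = few-legs t λ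
    { at0 → nb (member (copy t) 2F) (edge (copy t) 1F 2F refl)
    ; at1 → nb (member (copy t) 3F) (edge (copy t) 1F 3F refl)
    ; at2 → nb (member (copy t) 4F) (edge (copy t) 1F 4F refl) }

  -- Besides `u` and `w`, the vertex `v` has at most one neighbour. This covers a triangle `u v w`
  -- as well as two adjacent vertices of degree two.
  Tight : List (Fin n) → (u v w x : Fin n) → Set
  Tight S u v w x = (u ∈ S × v ∈ S × w ∈ S) × u ~ v × u ~ w × v ≢ w ×
    Neighbours⊆ S u (v ∷ w ∷ []) × Neighbours⊆ S v (u ∷ w ∷ x ∷ [])

  tight? : ∀ S u v w x → Dec (Tight S u v w x)
  tight? S u v w x = ((u ∈? S) ×-dec (v ∈? S) ×-dec (w ∈? S)) ×-dec (u ~? v) ×-dec (u ~? w) ×-dec ¬? (v ≟ w)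
    ×-dec neighbours⊆? S u (v ∷ w ∷ []) ×-dec neighbours⊆? S v (u ∷ w ∷ x ∷ [])

  module DegreeTwo {S} (S! : Unique S) (solve : ∀ T → Unique T → length T < length S → Solution T)
    (clean : Clean S) (noLeaf : ∀ {v u} → v ∈ S → ¬ IsLeaf S v u) where

    open Reduce S! solve
    open Cleaned clean

    other : ∀ {v} → v ∈ S → ∀ o → ∃ λ w → w ∈ S × v ~ w × w ≢ o
    other {v} v∈S o with beyond? S v (o ∷ [])
    ... | inj₁ (w , w∈S , v~w , w∉) = w , w∈S , v~w , λ { refl → w∉ at0 }
    ... | inj₂ nv with neighbour v∈S
    ...   | w , w∈S , v~w with nv w∈S v~w
    ...     | at0 = ⊥-elim (noLeaf w∈S (v∈S , v~w , nv))

    -- Without leaves every degree is at least two, so a list of two candidates is exact.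
    other∈ : ∀ {v o o′} → v ∈ S → Neighbours⊆ S v (o ∷ o′ ∷ []) → v ~ o × v ~ o′
    other∈ {v} {o} {o′} v∈S nv with other v∈S o | other v∈S o′
    ... | w , w∈S , v~w , w≢o | w′ , w′∈S , v~w′ , w′≢o′ with nv w∈S v~w | nv w′∈S v~w′
    ...   | at1 | at0 = v~w′ , v~w
    ...   | at0 | _   = ⊥-elim (w≢o refl)
    ...   | at1 | at1 = ⊥-elim (w′≢o′ refl)

    -- Three vertices for the edge `u v` leave room for one bad piece, and it contains `x`: a K₂,₃
    -- takes the whole boundary, and an isolated vertex not adjacent to `v` would have been a leaf
    -- at `w`.
    tight-solution : ∀ {u v w x} → Tight S u v w x → Solution S
    tight-solution {u} {v} {w} {x} ((u∈S , v∈S , w∈S) , u~v , u~w , v≢w , nu , nv) with other w∈S u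
    ... | w₁ , _ , w~w₁ , w₁≢u with third S (~-sym u~w) w~w₁ (≢-sym w₁≢u)
    ...   | w₂ , _ , _ , nw = reduce₁ x X 1 u∈S at0 noBad through ≤-refl
      (one-edge x u∈S v∈S at0 at1 u~v
        (λ z∈ e → ∈-skip (alive⇒∉ z∈) at2 (∈-skip (alive⇒∉ z∈) at1 (nu (∖-⊆ z∈) e)))
        (λ z∈ e → ∈-skip (alive⇒∉ z∈) at2 (∈-skip (alive⇒∉ z∈) at0 (nv (∖-⊆ z∈) e))))
      where
      X : List (Fin n)
      X = u ∷ v ∷ w ∷ []
      at-u : ∀ {b} → b ∈ S → b ∉ X → ¬ b ~ u
      at-u b∈ b∉ e = ∈[]-elim (∈-skip b∉ at2 (∈-skip b∉ at1 (nu b∈ (~-sym e))))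
      at-v : ∀ {b} → b ∈ S → b ∉ X → b ~ v → b ∈ x ∷ []
      at-v b∈ b∉ e = ∈-skip b∉ at2 (∈-skip b∉ at0 (nv b∈ (~-sym e)))
      frontier : Frontier S X (x ∷ w₁ ∷ w₂ ∷ [])
      frontier b∈ b∉ at0 e = ⊥-elim (at-u b∈ b∉ e)
      frontier b∈ b∉ at1 e = ∈-++⁺ˡ (at-v b∈ b∉ e)
      frontier b∈ b∉ at2 e = there (∈-skip b∉ at0 (nw b∈ (~-sym e)))
      through : ∀ κ vs → Bad κ (S ∖ X) vs → x ∈ toList vs
      through κ vs bad with view bad
      ... | attached-theta t = there (there (all-legs frontier t at0))
      ... | isolated {b} b∈ b∉ nb with b ~? v
      ...   | yes b~v = case at-v b∈ b∉ b~v of λ { at0 → at0 }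
      ...   | no b≁v with other b∈ w
      ...     | z , z∈S , b~z , z≢w with nb z∈S b~z
      ...       | at0 = ⊥-elim (at-u b∈ b∉ b~z)
      ...       | at1 = ⊥-elim (b≁v b~z)
      ...       | at2 = ⊥-elim (z≢w refl)

    -- The vertices x, p, q, x₁, x₂, c span K₃,₃ minus the edge x c.
    k33-minus-edge : ∀ {p q x₁ x₂ c x v e} → Copy theta S (p ∷ q ∷ x₁ ∷ x₂ ∷ c ∷ []) →
      x ∈ S → x ~ x₁ → x ~ x₂ → Neighbours⊆ S x (v ∷ x₁ ∷ x₂ ∷ []) → x ∉ p ∷ q ∷ x₁ ∷ x₂ ∷ c ∷ [] →
      e ∈ S → c ~ e → e ∉ p ∷ q ∷ [] → x ≢ e → Solution S
    k33-minus-edge {p} {q} {x₁} {x₂} {c} {x} {v} {e} t x∈S x~x₁ x~x₂ nx x∉t e∈S c~e e∉ x≢e with other e∈S c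
    ... | e₁ , _ , e~e₁ , e₁≢c with third S (~-sym c~e) e~e₁ (≢-sym e₁≢c)
    -- The path `x x₁ p c` is matched, and `v` may survive next to `x` only. The outer neighbour `e`
    -- of `c` is therefore deleted too: seven vertices and one debt use up exactly two edges.
    ...   | e₂ , _ , _ , ne = reduce₁ v X 2 x∈S at0 noBad through ≤-refl
      (path-edges v (x∈S ∷ member t 2F ∷ member t 0F ∷ member t 4F ∷ []) (at0 ∷ at3 ∷ at1 ∷ at5 ∷ [])
        (~-sym x~x₁) (edge t 4F 0F refl)
        (λ c~x → c≁x (nc c~x)) (no-edge t 4F 2F refl)
        (λ p~x → x∉t (there (there (hub₁ t p~x))))
        (λ { refl → x∉t at4 }) (distinct t 4F 2F (λ ())) (λ { refl → x∉t at0 }) (distinct t 0F 2F (λ ()))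
        (λ z∈ e → at-x (alive⇒∉ z∈) (nx (∖-⊆ z∈) e))
        (λ z∈ e → seal (alive⇒∉ z∈) at2 e)
        (λ z∈ e → seal (alive⇒∉ z∈) at0 e)
        (λ z∈ e → seal (alive⇒∉ z∈) at4 e))
      where
      t₂ = rotate t
      t₃ = rotate t₂
      x∉ : x ∉ p ∷ q ∷ []
      x∉ x∈ = x∉t (∈-++⁺ˡ x∈)
      n₁ : ∀ {w} → x₁ ~ w → w ∈ p ∷ q ∷ x ∷ []
      n₁ = leg-full t (~-sym x~x₁) x∉
      n₂ : ∀ {w} → x₂ ~ w → w ∈ p ∷ q ∷ x ∷ []
      n₂ = leg-full t₂ (~-sym x~x₂) x∉
      nc : ∀ {w} → c ~ w → w ∈ p ∷ q ∷ e ∷ []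
      nc = leg-full t₃ c~e e∉
      c≁x : ¬ x ∈ p ∷ q ∷ e ∷ []
      c≁x at0 = x∉ at0
      c≁x at1 = x∉ at1
      c≁x at2 = x≢e refl
      X : List (Fin n)
      X = x ∷ p ∷ q ∷ x₁ ∷ x₂ ∷ c ∷ e ∷ []
      at-x : ∀ {b} → b ∉ X → b ∈ v ∷ x₁ ∷ x₂ ∷ [] → b ∈ v ∷ []
      at-x b∉ at0 = at0
      at-x b∉ at1 = ⊥-elim (b∉ at3)
      at-x b∉ at2 = ⊥-elim (b∉ at4)
      seal : ∀ {b z} → b ∉ X → z ∈ p ∷ q ∷ x₁ ∷ x₂ ∷ c ∷ [] → z ~ b → b ∈ []
      seal b∉ at0 e = ∈-skip b∉ at5 (∈-skip b∉ at4 (∈-skip b∉ at3 (hub₁ t e)))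
      seal b∉ at1 e = ∈-skip b∉ at5 (∈-skip b∉ at4 (∈-skip b∉ at3 (hub₂ t e)))
      seal b∉ at2 e = ∈-skip b∉ at0 (∈-skip b∉ at2 (∈-skip b∉ at1 (n₁ e)))
      seal b∉ at3 e = ∈-skip b∉ at0 (∈-skip b∉ at2 (∈-skip b∉ at1 (n₂ e)))
      seal b∉ at4 e = ∈-skip b∉ at6 (∈-skip b∉ at2 (∈-skip b∉ at1 (nc e)))
      inner : ∀ {b z} → b ∉ X → z ∈ X → b ~ z → z ≡ x ⊎ z ≡ e
      inner b∉ at0 _ = inj₁ refl
      inner b∉ at1 e = ∈[]-elim (seal b∉ at0 (~-sym e))
      inner b∉ at2 e = ∈[]-elim (seal b∉ at1 (~-sym e))
      inner b∉ at3 e = ∈[]-elim (seal b∉ at2 (~-sym e))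
      inner b∉ at4 e = ∈[]-elim (seal b∉ at3 (~-sym e))
      inner b∉ at5 e = ∈[]-elim (seal b∉ at4 (~-sym e))
      inner b∉ at6 _ = inj₂ refl
      frontier : Frontier S X (v ∷ e₁ ∷ e₂ ∷ [])
      frontier b∈ b∉ z∈ b~z with inner b∉ z∈ b~z
      ... | inj₁ refl = ∈-++⁺ˡ (at-x b∉ (nx b∈ (~-sym b~z)))
      ... | inj₂ refl = there (∈-skip b∉ at5 (ne b∈ (~-sym b~z)))
      through : ∀ κ vs → Bad κ (S ∖ X) vs → v ∈ toList vs
      through κ vs bad with view bad
      ... | attached-theta t = there (there (all-legs frontier t at0))
      ... | isolated b∈ b∉ nb with other b∈ e
      ...   | z , z∈S , b~z , z≢e with inner b∉ (nb z∈S b~z) b~z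
      ...     | inj₁ refl = case at-x b∉ (nx b∈ (~-sym b~z)) of λ { at0 → at0 }
      ...     | inj₂ z≡e  = ⊥-elim (z≢e z≡e)

    -- Four vertices for the edge `u v`, with `t′` as the one surviving neighbour of `v`. The budget
    -- is exhausted, so nothing bad may arise; the freedom left is which end of the edges at `u`
    -- plays `v` and which of its further neighbours plays `t`.
    degree-two-step : ∀ {u v w t t′} → u ∈ S → v ∈ S → u ~ v → Neighbours⊆ S u (v ∷ w ∷ []) →
      (∀ {z} → v ~ z → z ∈ u ∷ t ∷ t′ ∷ []) → NoBad (S ∖ (u ∷ v ∷ w ∷ t ∷ [])) → Solution S
    degree-two-step {t′ = t′} u∈S v∈S u~v nu nv noBad′ = reduce₀ _ 1 u∈S at0 noBad′ ≤-refl
      (one-edge t′ u∈S v∈S at0 at1 u~v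
        (λ z∈ e → ∈-skip (alive⇒∉ z∈) at2 (∈-skip (alive⇒∉ z∈) at1 (nu (∖-⊆ z∈) e)))
        (λ z∈ e → ∈-skip (alive⇒∉ z∈) at3 (∈-skip (alive⇒∉ z∈) at0 (nv e))))

    -- Once its leg z is removed, an old K₂,₃ contributes neither its hubs nor its leg z′
    -- to the legs of a new one.
    dead-theta : ∀ {X Y p q z z′ l e o o′ p′ q′ a b c} → BadTheta (S ∖ X) p q z z′ l →
      z ∈ Y → e ∈ Y → z′ ~ e → e ∉ p ∷ q ∷ [] →
      Frontier S Y (z′ ∷ p ∷ q ∷ o ∷ o′ ∷ []) → ¬ BadTheta (S ∖ Y) p′ q′ a b c
    dead-theta {Y = Y} {p} {q} {z} {z′} {l} {e} {o} {o′} old z∈Y e∈Y z′~e e∉ frontier new = few-legs new λ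
      { at0 → last (rotate-bad new) (legs⊆ frontier new at0)
      ; at1 → last (rotate-bad (rotate-bad new)) (legs⊆ frontier new at1)
      ; at2 → last new (legs⊆ frontier new at2) }
      where
      n′ : Neighbours⊆ (S ∖ Y) z′ (p ∷ q ∷ [])
      n′ w∈ z′~w with leg-full (rotate (copy old)) z′~e e∉ z′~w
      ... | at0 = at0
      ... | at1 = at1
      ... | at2 = ⊥-elim (alive⇒∉ w∈ e∈Y)
      nh : ∀ {h} → h ∈ p ∷ q ∷ [] → Neighbours⊆ (S ∖ Y) h (z′ ∷ l ∷ [])
      nh at0 w∈ e = ∈-skip (alive⇒∉ w∈) z∈Y (hub₁ (copy old) e)
      nh at1 w∈ e = ∈-skip (alive⇒∉ w∈) z∈Y (hub₂ (copy old) e)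
      module _ {p′ q′ a b c} (t : BadTheta (S ∖ Y) p′ q′ a b c) where
        c~p′ = edge (copy t) 4F 0F refl
        c~q′ = edge (copy t) 4F 1F refl
        not-hub : c ∉ p ∷ q ∷ []
        not-hub c∈ with nh c∈ (member (copy t) 0F) c~p′ | nh c∈ (member (copy t) 1F) c~q′
        ... | at0 | _   = hub-degree t at0 n′
        ... | at1 | at0 = hub-degree t at1 n′
        ... | at1 | at1 = distinct (copy t) 0F 1F (λ ()) refl
        not-leg : c ≢ z′
        not-leg refl = hub-degree t at0 (nh (n′ (member (copy t) 0F) c~p′))
        last : c ∈ z′ ∷ p ∷ q ∷ o ∷ o′ ∷ [] → c ∈ o ∷ o′ ∷ []
        last (here c≡z′)               = ⊥-elim (not-leg c≡z′)
        last (there (here c≡p))         = ⊥-elim (not-hub (here c≡p))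
        last (there (there (here c≡q))) = ⊥-elim (not-hub (there (here c≡q)))
        last (there (there (there c∈))) = c∈

    module Branching (noTight : ∀ {u v w x} → ¬ Tight S u v w x) where

      -- A degree-two vertex u on a 4-cycle u v x w.
      module Square {u v w x x′ z} (u∈S : u ∈ S) (v∈S : v ∈ S) (w∈S : w ∈ S) (x∈S : x ∈ S) (x′∈S : x′ ∈ S) (z∈S : z ∈ S)
        (u~v : u ~ v) (u~w : u ~ w) (v≢w : v ≢ w) (nu : Neighbours⊆ S u (v ∷ w ∷ []))
        (v~x : v ~ x) (v~x′ : v ~ x′) (w~x : w ~ x) (w~z : w ~ z)
        (x≢u : x ≢ u) (x′≢u : x′ ≢ u) (z≢u : z ≢ u) (x′≢x : x′ ≢ x) (z≢x : z ≢ x) where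

        nv : ∀ {t} → v ~ t → t ∈ u ∷ x ∷ x′ ∷ []
        nv = saturated (~-sym u~v) v~x v~x′ (≢-sym x≢u) (≢-sym x′≢u) (≢-sym x′≢x)

        nw : ∀ {t} → w ~ t → t ∈ u ∷ x ∷ z ∷ []
        nw = saturated (~-sym u~w) w~x w~z (≢-sym x≢u) (≢-sym z≢u) (≢-sym z≢x)

        u≁ : ∀ {t} → t ∈ S → t ≢ v → t ≢ w → ¬ u ~ t
        u≁ t∈S t≢v t≢w u~t with nu t∈S u~t
        ... | at0 = t≢v refl
        ... | at1 = t≢w refl

        -- If they coincided, `v` and `w` would share the neighbours `x`, `x′`, `u`: a K₄⁺ if
        -- `x ~ x′`, and otherwise a K₂,₃ with the free leg `u`. A clean set contains neither.
        x′≢z : x′ ≢ z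
        x′≢z refl with x ~? x′
        ... | yes x~x′ = noK4+ _ (k4+-copy (v∈S ∷ w∈S ∷ x∈S ∷ x′∈S ∷ u∈S ∷ []) v≢w x≢u x′≢u
          v~x v~x′ w~x w~z x~x′ (~-sym u~v) (~-sym u~w))
        ... | no x≁x′ = noFreeLeg (theta-copy (v∈S ∷ w∈S ∷ x∈S ∷ x′∈S ∷ u∈S ∷ []) v≢w (≢-sym x′≢x) x≢u x′≢u
          v~x v~x′ (~-sym u~v) w~x w~z (~-sym u~w) x≁x′
          (λ x~u → u≁ x∈S (≢-sym (~⇒≢ v~x)) (≢-sym (~⇒≢ w~x)) (~-sym x~u))
          (λ x′~u → u≁ x′∈S (≢-sym (~⇒≢ v~x′)) (≢-sym (~⇒≢ w~z)) (~-sym x′~u))) nu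

        w≁x′ : ¬ w ~ x′
        w≁x′ w~x′ with nw w~x′
        ... | at0 = x′≢u refl
        ... | at1 = x′≢x refl
        ... | at2 = x′≢z refl

        b≁u : ∀ {b t} → b ∈ S → b ∉ u ∷ v ∷ w ∷ t ∷ [] → ¬ b ~ u
        b≁u b∈ b∉ b~u = u≁ b∈ (λ { refl → b∉ at1 }) (λ { refl → b∉ at2 }) (~-sym b~u)

        -- Isolated vertices of S ∖ {u, v, w, x} would have degree two and lie on a triangle.
        not-isolated : ∀ {b} → b ∈ S → b ∉ u ∷ v ∷ w ∷ x ∷ [] → ¬ Neighbours⊆ S b (u ∷ v ∷ w ∷ x ∷ [])
        not-isolated {b} b∈ b∉ nb with b ~? v
        ... | yes b~v with ∈-skip b∉ at3 (∈-skip b∉ at0 (nv (~-sym b~v)))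
        ...   | at0 = noTight ((b∈ , v∈S , x∈S) , b~v , proj₂ (other∈ b∈ nb′) , ~⇒≢ v~x , nb′ ,
                               λ _ e → case nv e of λ { at0 → at2 ; at1 → at1 ; at2 → at0 })
          where
          nb′ : Neighbours⊆ S b (v ∷ x ∷ [])
          nb′ t∈ e with nb t∈ e
          ... | at0 = ⊥-elim (b≁u b∈ b∉ e)
          ... | at1 = at0
          ... | at2 = ⊥-elim (w≁x′ (~-sym e))
          ... | at3 = at1
        not-isolated {b} b∈ b∉ nb | no b≁v = conclude (∈-skip b∉ at3 (∈-skip b∉ at0 (nw (~-sym b~w))))
          where
          nb′ : Neighbours⊆ S b (w ∷ x ∷ [])
          nb′ t∈ e with nb t∈ e
          ... | at0 = ⊥-elim (b≁u b∈ b∉ e)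
          ... | at1 = ⊥-elim (b≁v e)
          ... | at2 = at0
          ... | at3 = at1
          b~w = proj₁ (other∈ b∈ nb′)
          conclude : b ∈ z ∷ [] → ⊥
          conclude at0 = noTight ((b∈ , w∈S , x∈S) , b~w , proj₂ (other∈ b∈ nb′) , ~⇒≢ w~x , nb′ ,
            λ _ e → case nw e of λ { at0 → at2 ; at1 → at1 ; at2 → at0 })

        -- If deleting x leaves a K₂,₃ with legs x′, z and l, then x′ is deleted instead.
        delete-x′ : ∀ {p q l} → BadTheta (S ∖ (u ∷ v ∷ w ∷ x ∷ [])) p q x′ z l → x ~ l → Solution S
        delete-x′ {p} {q} {l} t x~l = degree-two-step u∈S v∈S u~v nu (λ e → case nv e of λ { at0 → at0 ; at1 → at2 ; at2 → at1 }) noBad′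
          where
          X : List (Fin n)
          X = u ∷ v ∷ w ∷ x′ ∷ []
          nx′ : ∀ {t} → x′ ~ t → t ∈ p ∷ q ∷ v ∷ []
          nx′ = saturated (edge (copy t) 2F 0F refl) (edge (copy t) 2F 1F refl) (~-sym v~x′) (distinct (copy t) 0F 1F (λ ()))
            (λ { refl → bad∉ t 0F at1 }) (λ { refl → bad∉ t 1F at1 })
          l∉X : l ∉ X
          l∉X at0 = bad∉ t 4F at0
          l∉X at1 = bad∉ t 4F at1
          l∉X at2 = bad∉ t 4F at2
          l∉X at3 = distinct (copy t) 4F 2F (λ ()) refl
          -- `x` occurs twice because `dead-theta` reserves two places for boundary vertices outside
          -- the old K₂,₃.
          frontier : Frontier S X (z ∷ p ∷ q ∷ x ∷ x ∷ [])
          frontier b∈ b∉ at0 e = ⊥-elim (b≁u b∈ b∉ e)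
          frontier b∈ b∉ at1 e with nv (~-sym e)
          ... | at0 = ⊥-elim (b∉ at0)
          ... | at1 = at3
          ... | at2 = ⊥-elim (b∉ at3)
          frontier b∈ b∉ at2 e with nw (~-sym e)
          ... | at0 = ⊥-elim (b∉ at0)
          ... | at1 = at3
          ... | at2 = at0
          frontier b∈ b∉ at3 e with nx′ (~-sym e)
          ... | at0 = at1
          ... | at1 = at2
          ... | at2 = ⊥-elim (b∉ at1)
          hub-alive : ∀ {h} → h ~ z → ¬ Neighbours⊆ S h (w ∷ x′ ∷ [])
          hub-alive h~z nh with nh z∈S h~z
          ... | at0 = ~⇒≢ w~z refl
          ... | at1 = x′≢z refl
          noBad′ : NoBad (S ∖ X)
          noBad′ κ vs bad with view bad
          ... | attached-theta s = dead-theta t at3 at2 (~-sym w~z)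
            (λ { at0 → bad∉ t 0F at2 ; at1 → bad∉ t 1F at2 }) frontier s
          ... | isolated {b} b∈ b∉ nb with b ~? v
          ...   | yes b~v with nv (~-sym b~v)
          ...     | at0 = b∉ at0
          ...     | at1 = l∉X (nb (bad∈ t 4F) x~l)
          ...     | at2 = b∉ at3
          noBad′ κ vs bad | isolated {b} b∈ b∉ nb | no b≁v = case nx′ (~-sym (proj₂ (other∈ b∈ nb′))) of λ
            { at0 → hub-alive (edge (copy t) 0F 3F refl) nb′
            ; at1 → hub-alive (edge (copy t) 1F 3F refl) nb′
            ; at2 → b∉ at1 }
            where
            nb′ : Neighbours⊆ S b (w ∷ x′ ∷ [])
            nb′ t∈ e with nb t∈ e
            ... | at0 = ⊥-elim (b≁u b∈ b∉ e)
            ... | at1 = ⊥-elim (b≁v e)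
            ... | at2 = at0
            ... | at3 = at1

        solution : Solution S
        solution with findBad (S ∖ (u ∷ v ∷ w ∷ x ∷ []))
        ... | inj₂ noBad′ = degree-two-step u∈S v∈S u~v nu nv noBad′
        ... | inj₁ (κ , vs , bad) with view bad
        ...   | isolated b∈ b∉ nb = ⊥-elim (not-isolated b∈ b∉ nb)
        ...   | attached-theta {p} {q} t with third S (~-sym v~x) (~-sym w~x) v≢w
        ...     | x₃ , x~x₃ , _ , nx = finish
          where
          X : List (Fin n)
          X = u ∷ v ∷ w ∷ x ∷ []
          frontier : Frontier S X (x′ ∷ z ∷ x₃ ∷ [])
          frontier b∈ b∉ at0 e = ⊥-elim (b≁u b∈ b∉ e)
          frontier b∈ b∉ at1 e = ∈-++⁺ˡ (∈-skip b∉ at3 (∈-skip b∉ at0 (nv (~-sym e))))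
          frontier b∈ b∉ at2 e with ∈-skip b∉ at3 (∈-skip b∉ at0 (nw (~-sym e)))
          ... | at0 = at1
          frontier b∈ b∉ at3 e = there (there (∈-skip b∉ at2 (∈-skip b∉ at1 (nx b∈ (~-sym e)))))
          finish : Solution S
          finish with arrange t (all-legs frontier t at0) (all-legs frontier t at1) x′≢z
          ... | l , t′ with legs⊆ frontier t′ at2
          ...   | at0 = ⊥-elim (distinct (copy t′) 4F 2F (λ ()) refl)
          ...   | at1 = ⊥-elim (distinct (copy t′) 4F 3F (λ ()) refl)
          ...   | at2 = delete-x′ t′ x~x₃

      -- A degree-two vertex u on no 4-cycle, its neighbours v and w, and theirs.
      record Fork (u v w x x′ y y′ : Fin n) : Set where
        field
          u∈S  : u ∈ S
          v∈S  : v ∈ S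
          w∈S  : w ∈ S
          x∈S  : x ∈ S
          x′∈S : x′ ∈ S
          y∈S  : y ∈ S
          y′∈S : y′ ∈ S
          u~v  : u ~ v
          u~w  : u ~ w
          v≢w  : v ≢ w
          nu   : Neighbours⊆ S u (v ∷ w ∷ [])
          v~x  : v ~ x
          v~x′ : v ~ x′
          x≢u  : x ≢ u
          x′≢u : x′ ≢ u
          x≢x′ : x ≢ x′
          w~y  : w ~ y
          w~y′ : w ~ y′
          y≢u  : y ≢ u
          y′≢u : y′ ≢ u
          y≢y′ : y ≢ y′
          v≁w  : ¬ v ~ w
          w≁x  : ¬ w ~ x
          w≁x′ : ¬ w ~ x′

        nv : ∀ {t} → v ~ t → t ∈ u ∷ x ∷ x′ ∷ []
        nv = saturated (~-sym u~v) v~x v~x′ (≢-sym x≢u) (≢-sym x′≢u) x≢x′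

        nw : ∀ {t} → w ~ t → t ∈ u ∷ y ∷ y′ ∷ []
        nw = saturated (~-sym u~w) w~y w~y′ (≢-sym y≢u) (≢-sym y′≢u) y≢y′

        b≁u : ∀ {b X} → v ∈ X → w ∈ X → b ∈ S → b ∉ X → ¬ b ~ u
        b≁u v∈X w∈X b∈ b∉ b~u with nu b∈ (~-sym b~u)
        ... | at0 = b∉ v∈X
        ... | at1 = b∉ w∈X

      open Fork

      swap-x : ∀ {u v w x x′ y y′} → Fork u v w x x′ y y′ → Fork u v w x′ x y y′
      swap-x f = record
        { u∈S = u∈S f ; v∈S = v∈S f ; w∈S = w∈S f ; x∈S = x′∈S f ; x′∈S = x∈S f ; y∈S = y∈S f ; y′∈S = y′∈S f
        ; u~v = u~v f ; u~w = u~w f ; v≢w = v≢w f ; nu = nu f ; v~x = v~x′ f ; v~x′ = v~x f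
        ; x≢u = x′≢u f ; x′≢u = x≢u f ; x≢x′ = ≢-sym (x≢x′ f) ; w~y = w~y f ; w~y′ = w~y′ f
        ; y≢u = y≢u f ; y′≢u = y′≢u f ; y≢y′ = y≢y′ f ; v≁w = v≁w f ; w≁x = w≁x′ f ; w≁x′ = w≁x f }

      swap-sides : ∀ {u v w x x′ y y′} → Fork u v w x x′ y y′ → Fork u w v y y′ x x′
      swap-sides {u} {v} {w} f = record
        { u∈S = u∈S f ; v∈S = w∈S f ; w∈S = v∈S f ; x∈S = y∈S f ; x′∈S = y′∈S f ; y∈S = x∈S f ; y′∈S = x′∈S f
        ; u~v = u~w f ; u~w = u~v f ; v≢w = ≢-sym (v≢w f) ; v~x = w~y f ; v~x′ = w~y′ f
        ; nu = λ t∈ e → case nu f t∈ e of λ { at0 → at1 ; at1 → at0 }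
        ; x≢u = y≢u f ; x′≢u = y′≢u f ; x≢x′ = y≢y′ f ; w~y = v~x f ; w~y′ = v~x′ f
        ; y≢u = x≢u f ; y′≢u = x′≢u f ; y≢y′ = x≢x′ f ; v≁w = λ e → v≁w f (~-sym e)
        ; w≁x = disjoint (y≢u f) (w~y f) ; w≁x′ = disjoint (y′≢u f) (w~y′ f) }
        where
        disjoint : ∀ {t} → t ≢ u → w ~ t → ¬ v ~ t
        disjoint t≢u w~t v~t with nv f v~t
        ... | at0 = t≢u refl
        ... | at1 = w≁x f w~t
        ... | at2 = w≁x′ f w~t

      swap-y : ∀ {u v w x x′ y y′} → Fork u v w x x′ y y′ → Fork u v w x x′ y′ y
      swap-y f = swap-sides (swap-x (swap-sides f))

      -- An isolated vertex adjacent to `v` could only be `x′`, of degree two in the triangle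
      -- `x′ v x`, which is tight.
      isolated-near : ∀ {u v w x x′ y y′ b} → Fork u v w x x′ y y′ → b ∈ S → b ∉ u ∷ v ∷ w ∷ x ∷ [] →
        Neighbours⊆ S b (u ∷ v ∷ w ∷ x ∷ []) → Neighbours⊆ S b (w ∷ x ∷ [])
      isolated-near {u} {v} {w} {x} {b = b} f b∈ b∉ nb with b ~? v
      ... | no b≁v = λ t∈ e → case nb t∈ e of λ
        { at0 → ⊥-elim (b≁u f at1 at2 b∈ b∉ e) ; at1 → ⊥-elim (b≁v e) ; at2 → at0 ; at3 → at1 }
      ... | yes b~v with ∈-skip b∉ at3 (∈-skip b∉ at0 (nv f (~-sym b~v)))
      ...   | at0 = ⊥-elim (noTight ((b∈ , v∈S f , x∈S f) , b~v , proj₂ (other∈ b∈ nb′) , ~⇒≢ (v~x f) , nb′ ,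
                     λ _ e → case nv f e of λ { at0 → at2 ; at1 → at1 ; at2 → at0 }))
        where
        nb′ : Neighbours⊆ S b (v ∷ x ∷ [])
        nb′ t∈ e with nb t∈ e
        ... | at0 = ⊥-elim (b≁u f at1 at2 b∈ b∉ e)
        ... | at1 = at0
        ... | at2 = ⊥-elim (w≁x′ f (~-sym e))
        ... | at3 = at1

      fork-step : ∀ {u v w x x′ y y′} → Fork u v w x x′ y y′ → NoBad (S ∖ (u ∷ v ∷ w ∷ x ∷ [])) → Solution S
      fork-step f = degree-two-step (u∈S f) (v∈S f) (u~v f) (nu f) (nv f)

      -- Deleting `y` in place of `x` works. A K₂,₃ would need `x` as a leg, but `x` has lost both
      -- `v` and `y`; an isolated vertex would have to be `x` itself, giving adjacent vertices `x`
      -- and `y` of degree two, which is tight.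
      isolated-solution : ∀ {u v w x x′ y y′} → Fork u v w x x′ y y′ → Neighbours⊆ S y (w ∷ x ∷ []) → Solution S
      isolated-solution {u} {v} {w} {x} {x′} {y} {y′} f ny with third S (~-sym (v~x f)) x~y v≢y
        where
        x~y = ~-sym (proj₂ (other∈ (y∈S f) ny))
        v≢y : v ≢ y
        v≢y refl = v≁w f (~-sym (w~y f))
      ... | x₃ , _ , _ , nx = fork-step g noBad′
        where
        g = swap-sides f
        X : List (Fin n)
        X = u ∷ w ∷ v ∷ y ∷ []
        frontier : Frontier S X (x ∷ x′ ∷ y′ ∷ [])
        frontier b∈ b∉ at0 e = ⊥-elim (b≁u f at2 at1 b∈ b∉ e)
        frontier b∈ b∉ at1 e = there (there (∈-skip b∉ at3 (∈-skip b∉ at0 (nw f (~-sym e)))))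
        frontier b∈ b∉ at2 e = ∈-++⁺ˡ (∈-skip b∉ at0 (nv f (~-sym e)))
        frontier b∈ b∉ at3 e = ∈-++⁺ˡ (∈-skip b∉ at1 (ny b∈ (~-sym e)))
        noBad′ : NoBad (S ∖ X)
        noBad′ κ vs bad with view bad
        ... | attached-theta t = theta-degree t (all-legs frontier t at0)
          (λ z∈ e → ∈-skip (alive⇒∉ z∈) at3 (∈-skip (alive⇒∉ z∈) at2 (nx (∖-⊆ z∈) e)))
        ... | isolated {b} b∈ b∉ nb with isolated-near g b∈ b∉ nb
        ...   | nb′ with ∈-skip b∉ at1 (ny b∈ (~-sym (proj₂ (other∈ b∈ nb′))))
        ...     | at0 = noTight ((b∈ , y∈S f , v∈S f) , proj₂ (other∈ b∈ nb′) , proj₁ (other∈ b∈ nb′) , y≢v ,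
                        (λ t∈ e → case nb′ t∈ e of λ { at0 → at1 ; at1 → at0 }) ,
                        λ t∈ e → case ny t∈ e of λ { at0 → at2 ; at1 → at0 })
          where
          y≢v : y ≢ v
          y≢v refl = v≁w f (~-sym (w~y f))

      -- In the next two lemmas the K₂,₃ left by deleting x has two legs among the old vertices;
      -- deleting one of these two instead of x leaves nothing bad.
      both-far : ∀ {u v w x x′ y y′ p q l} → Fork u v w x x′ y y′ →
        BadTheta (S ∖ (u ∷ v ∷ w ∷ x ∷ [])) p q y y′ l → Solution S
      both-far {u} {v} {w} {x} {x′} {y} {y′} {p} {q} f t = fork-step g noBad′
        where
        g = swap-sides f
        w∉ : w ∉ p ∷ q ∷ []
        w∉ at0 = bad∉ t 0F at2
        w∉ at1 = bad∉ t 1F at2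
        ny : ∀ {z} → y ~ z → z ∈ p ∷ q ∷ w ∷ []
        ny = leg-full (copy t) (~-sym (w~y f)) w∉
        X : List (Fin n)
        X = u ∷ w ∷ v ∷ y ∷ []
        frontier : Frontier S X (y′ ∷ p ∷ q ∷ x ∷ x′ ∷ [])
        frontier b∈ b∉ at0 e = ⊥-elim (b≁u f at2 at1 b∈ b∉ e)
        frontier b∈ b∉ at1 e = ∈-++⁺ˡ (∈-skip b∉ at3 (∈-skip b∉ at0 (nw f (~-sym e))))
        frontier b∈ b∉ at2 e = there (there (there (∈-skip b∉ at0 (nv f (~-sym e)))))
        frontier b∈ b∉ at3 e with ny (~-sym e)
        ... | at0 = at1
        ... | at1 = at2
        ... | at2 = ⊥-elim (b∉ at1)
        hub-alive : ∀ {h} → h ~ y′ → ¬ Neighbours⊆ S h (v ∷ y ∷ [])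
        hub-alive h~y′ nh with nh (y′∈S f) h~y′
        ... | at0 = v≁w f (~-sym (w~y′ f))
        ... | at1 = y≢y′ f refl
        noBad′ : NoBad (S ∖ X)
        noBad′ κ vs bad with view bad
        ... | attached-theta s = dead-theta t at3 at1 (~-sym (w~y′ f)) w∉ frontier s
        ... | isolated b∈ b∉ nb with isolated-near g b∈ b∉ nb
        ...   | nb′ with ny (~-sym (proj₂ (other∈ b∈ nb′)))
        ...     | at0 = hub-alive (edge (copy t) 0F 3F refl) nb′
        ...     | at1 = hub-alive (edge (copy t) 1F 3F refl) nb′
        ...     | at2 = b∉ at1

      near-and-far : ∀ {u v w x x′ y y′ p q l} → Fork u v w x x′ y y′ →
        BadTheta (S ∖ (u ∷ v ∷ w ∷ x ∷ [])) p q x′ y l → Solution S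
      near-and-far {u} {v} {w} {x} {x′} {y} {y′} {p} {q} f t = fork-step g noBad′
        where
        g = swap-x f
        w∉ : w ∉ p ∷ q ∷ []
        w∉ at0 = bad∉ t 0F at2
        w∉ at1 = bad∉ t 1F at2
        nx′ : ∀ {z} → x′ ~ z → z ∈ p ∷ q ∷ v ∷ []
        nx′ = leg-full (copy t) (~-sym (v~x′ f)) (λ { at0 → bad∉ t 0F at1 ; at1 → bad∉ t 1F at1 })
        X : List (Fin n)
        X = u ∷ v ∷ w ∷ x′ ∷ []
        frontier : Frontier S X (y ∷ p ∷ q ∷ x ∷ y′ ∷ [])
        frontier b∈ b∉ at0 e = ⊥-elim (b≁u f at1 at2 b∈ b∉ e)
        frontier b∈ b∉ at1 e with nv f (~-sym e)
        ... | at0 = ⊥-elim (b∉ at0)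
        ... | at1 = at3
        ... | at2 = ⊥-elim (b∉ at3)
        frontier b∈ b∉ at2 e with nw f (~-sym e)
        ... | at0 = ⊥-elim (b∉ at0)
        ... | at1 = at0
        ... | at2 = at4
        frontier b∈ b∉ at3 e with nx′ (~-sym e)
        ... | at0 = at1
        ... | at1 = at2
        ... | at2 = ⊥-elim (b∉ at1)
        hub-alive : ∀ {h} → h ~ y → ¬ Neighbours⊆ S h (w ∷ x′ ∷ [])
        hub-alive h~y nh with nh (y∈S f) h~y
        ... | at0 = ~⇒≢ (w~y f) refl
        ... | at1 = w≁x′ f (w~y f)
        noBad′ : NoBad (S ∖ X)
        noBad′ κ vs bad with view bad
        ... | attached-theta s = dead-theta t at3 at2 (~-sym (w~y f)) w∉ frontier s
        ... | isolated b∈ b∉ nb with isolated-near g b∈ b∉ nb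
        ...   | nb′ with nx′ (~-sym (proj₂ (other∈ b∈ nb′)))
        ...     | at0 = hub-alive (edge (copy t) 0F 3F refl) nb′
        ...     | at1 = hub-alive (edge (copy t) 1F 3F refl) nb′
        ...     | at2 = b∉ at1

      -- The three legs lie among `x′`, `y`, `y′`, `x₁`, `x₂`. The pairs `y y′`, `x₁ x₂`, and `x′`
      -- with `y` or `y′` have reductions of their own; a set avoiding all these pairs has at most
      -- two elements.
      module ForkTheta {u v w x x′ y y′ p q a b c} (f : Fork u v w x x′ y y′)
        (t : BadTheta (S ∖ (u ∷ v ∷ w ∷ x ∷ [])) p q a b c)
        {x₁ x₂} (x~x₁ : x ~ x₁) (x~x₂ : x ~ x₂) (x₁≢x₂ : x₁ ≢ x₂) (nx : Neighbours⊆ S x (v ∷ x₁ ∷ x₂ ∷ [])) where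

        X : List (Fin n)
        X = u ∷ v ∷ w ∷ x ∷ []

        frontier : Frontier S X (x′ ∷ y ∷ y′ ∷ x₁ ∷ x₂ ∷ [])
        frontier b∈ b∉ at0 e = ⊥-elim (b≁u f at1 at2 b∈ b∉ e)
        frontier b∈ b∉ at1 e = ∈-++⁺ˡ (∈-skip b∉ at3 (∈-skip b∉ at0 (nv f (~-sym e))))
        frontier b∈ b∉ at2 e = there (∈-++⁺ˡ (∈-skip b∉ at0 (nw f (~-sym e))))
        frontier b∈ b∉ at3 e = there (there (there (∈-skip b∉ at1 (nx b∈ (~-sym e)))))

        -- The hubs are joined to `x₁`, `x₂` and the third leg `l`, and `x` to the first two: a K₃,₃
        -- without the edge `x l`. All neighbours of `x` being known, the edge from `l` to the
        -- deleted set ends elsewhere.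
        both-x : x₁ ∈ a ∷ b ∷ c ∷ [] → x₂ ∈ a ∷ b ∷ c ∷ [] → Solution S
        both-x x₁∈ x₂∈ with arrange t x₁∈ x₂∈ x₁≢x₂
        ... | l , s with touch s
        ...   | e , e∈X , e∈S , l~e = k33-minus-edge (copy-mono ∖-⊆ (copy s)) (x∈S f) x~x₁ x~x₂ nx x∉ e∈S l~e
          (λ { at0 → bad∉ s 0F e∈X ; at1 → bad∉ s 1F e∈X }) x≢e
          where
          x∉ : x ∉ p ∷ q ∷ x₁ ∷ x₂ ∷ l ∷ []
          x∉ x∈ with index (p ∷ q ∷ x₁ ∷ x₂ ∷ l ∷ []) x∈
          ... | i , eq = bad∉ s i (subst (_∈ X) eq at3)
          x≢e : x ≢ e
          x≢e refl with nx (bad∈ s 4F) (~-sym l~e)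
          ... | at0 = bad∉ s 4F at1
          ... | at1 = distinct (copy s) 4F 2F (λ ()) refl
          ... | at2 = distinct (copy s) 4F 3F (λ ()) refl

        sieve : ∀ {O} → (∀ {z} → z ∈ x′ ∷ y ∷ y′ ∷ x₁ ∷ x₂ ∷ [] → z ∈ a ∷ b ∷ c ∷ [] → z ∈ O) → a ∷ b ∷ c ∷ [] ⊆ O
        sieve keep z∈ = keep (legs⊆ frontier t z∈) z∈

        x′≢far : ∀ {z} → w ~ z → x′ ≢ z
        x′≢far w~z refl = w≁x′ f w~z

        solution : Solution S
        solution with y ∈? (a ∷ b ∷ c ∷ []) | y′ ∈? (a ∷ b ∷ c ∷ []) | x₁ ∈? (a ∷ b ∷ c ∷ []) | x₂ ∈? (a ∷ b ∷ c ∷ []) | x′ ∈? (a ∷ b ∷ c ∷ [])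
        ... | yes y∈ | yes y′∈ | _ | _ | _ = both-far f (proj₂ (arrange t y∈ y′∈ (y≢y′ f)))
        ... | _ | _ | yes x₁∈ | yes x₂∈ | _ = both-x x₁∈ x₂∈
        ... | yes y∈ | _ | _ | _ | yes x′∈ = near-and-far f (proj₂ (arrange t x′∈ y∈ (x′≢far (w~y f))))
        ... | _ | yes y′∈ | _ | _ | yes x′∈ = near-and-far (swap-y f) (proj₂ (arrange t x′∈ y′∈ (x′≢far (w~y′ f))))
        ... | no y∉ | no y′∉ | no x₁∉ | _ | _ = ⊥-elim (few-legs t (sieve {x′ ∷ x₂ ∷ []} λ
          { at0 _ → at0 ; at1 m → ⊥-elim (y∉ m) ; at2 m → ⊥-elim (y′∉ m) ; at3 m → ⊥-elim (x₁∉ m) ; at4 _ → at1 }))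
        ... | no y∉ | no y′∉ | yes _ | no x₂∉ | _ = ⊥-elim (few-legs t (sieve {x′ ∷ x₁ ∷ []} λ
          { at0 _ → at0 ; at1 m → ⊥-elim (y∉ m) ; at2 m → ⊥-elim (y′∉ m) ; at3 _ → at1 ; at4 m → ⊥-elim (x₂∉ m) }))
        ... | yes _ | no y′∉ | no x₁∉ | _ | no x′∉ = ⊥-elim (few-legs t (sieve {y ∷ x₂ ∷ []} λ
          { at0 m → ⊥-elim (x′∉ m) ; at1 _ → at0 ; at2 m → ⊥-elim (y′∉ m) ; at3 m → ⊥-elim (x₁∉ m) ; at4 _ → at1 }))
        ... | yes _ | no y′∉ | yes _ | no x₂∉ | no x′∉ = ⊥-elim (few-legs t (sieve {y ∷ x₁ ∷ []} λ
          { at0 m → ⊥-elim (x′∉ m) ; at1 _ → at0 ; at2 m → ⊥-elim (y′∉ m) ; at3 _ → at1 ; at4 m → ⊥-elim (x₂∉ m) }))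
        ... | no y∉ | yes _ | no x₁∉ | _ | no x′∉ = ⊥-elim (few-legs t (sieve {y′ ∷ x₂ ∷ []} λ
          { at0 m → ⊥-elim (x′∉ m) ; at1 m → ⊥-elim (y∉ m) ; at2 _ → at0 ; at3 m → ⊥-elim (x₁∉ m) ; at4 _ → at1 }))
        ... | no y∉ | yes _ | yes _ | no x₂∉ | no x′∉ = ⊥-elim (few-legs t (sieve {y′ ∷ x₁ ∷ []} λ
          { at0 m → ⊥-elim (x′∉ m) ; at1 m → ⊥-elim (y∉ m) ; at2 _ → at0 ; at3 _ → at1 ; at4 m → ⊥-elim (x₂∉ m) }))

      fork-solution : ∀ {u v w x x′ y y′} → Fork u v w x x′ y y′ → Solution S
      fork-solution {u} {v} {w} {x} {x′} {y} {y′} f with findBad (S ∖ (u ∷ v ∷ w ∷ x ∷ []))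
      ... | inj₂ noBad′ = fork-step f noBad′
      ... | inj₁ (κ , vs , bad) with view bad
      ...   | isolated b∈ b∉ nb with isolated-near f b∈ b∉ nb
      ...     | nb′ with ∈-skip b∉ at0 (nw f (~-sym (proj₁ (other∈ b∈ nb′))))
      ...       | at0 = isolated-solution f nb′
      ...       | at1 = isolated-solution (swap-y f) nb′
      fork-solution {v = v} f | inj₁ (κ , vs , bad) | attached-theta t with other (x∈S f) v
      -- If `x` has degree two, then `x₂` is `v`: still a neighbour of `x` different from `x₁`, but
      -- deleted and so never a leg.
      ...     | x₁ , _ , x~x₁ , x₁≢v with third S (~-sym (v~x f)) x~x₁ (≢-sym x₁≢v)
      ...       | x₂ , x~x₂ , x₂≢x₁ , nx = ForkTheta.solution f t x~x₁ x~x₂ (≢-sym x₂≢x₁) nx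

      solution : ∀ {u v w} → u ∈ S → v ∈ S → w ∈ S → u ~ v → u ~ w → v ≢ w → Neighbours⊆ S u (v ∷ w ∷ []) → Solution S
      solution {u} {v} {w} u∈S v∈S w∈S u~v u~w v≢w nu
        with branch v∈S w∈S u~v u~w v≢w nu | branch w∈S v∈S u~w u~v (≢-sym v≢w) (λ t∈ e → case nu t∈ e of λ { at0 → at1 ; at1 → at0 })
        where
        branch : ∀ {v w} → v ∈ S → w ∈ S → u ~ v → u ~ w → v ≢ w → Neighbours⊆ S u (v ∷ w ∷ []) →
          ∃₂ λ x x′ → x ∈ S × x′ ∈ S × v ~ x × v ~ x′ × x ∉ u ∷ w ∷ [] × x′ ∉ u ∷ w ∷ x ∷ []
        branch {v} {w} v∈S w∈S u~v u~w v≢w nu with beyond? S v (u ∷ w ∷ [])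
        ... | inj₂ nv = ⊥-elim (noTight {x = u} ((u∈S , v∈S , w∈S) , u~v , u~w , v≢w , nu , λ t∈ e → ∈-++⁺ˡ (nv t∈ e)))
        ... | inj₁ (x , x∈S , v~x , x∉) with beyond? S v (u ∷ w ∷ x ∷ [])
        ...   | inj₂ nv = ⊥-elim (noTight ((u∈S , v∈S , w∈S) , u~v , u~w , v≢w , nu , nv))
        ...   | inj₁ (x′ , x′∈S , v~x′ , x′∉) = x , x′ , x∈S , x′∈S , v~x , v~x′ , x∉ , x′∉
      ... | x , x′ , x∈S , x′∈S , v~x , v~x′ , x∉ , x′∉ | y , y′ , y∈S , y′∈S , w~y , w~y′ , y∉ , y′∉ = choose
        where
        x≢ : x ≢ u
        x≢ refl = x∉ at0
        x′≢ : x′ ≢ u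
        x′≢ refl = x′∉ at0
        x′≢x : x′ ≢ x
        x′≢x refl = x′∉ at2
        y≢ : y ≢ u
        y≢ refl = y∉ at0
        y′≢ : y′ ≢ u
        y′≢ refl = y′∉ at0
        y′≢y : y′ ≢ y
        y′≢y refl = y′∉ at2
        at-w : ∀ {t} → w ~ t → t ∈ u ∷ y ∷ y′ ∷ []
        at-w = saturated (~-sym u~w) w~y w~y′ (≢-sym y≢) (≢-sym y′≢) (≢-sym y′≢y)
        v≁ : ¬ v ~ w
        v≁ v~w with saturated (~-sym u~v) v~x v~x′ (≢-sym x≢) (≢-sym x′≢) (≢-sym x′≢x) v~w
        ... | at0 = ~⇒≢ u~w refl
        ... | at1 = x∉ at1
        ... | at2 = x′∉ at1
        square : ∀ {x x′} → x ∈ S → x′ ∈ S → v ~ x → v ~ x′ → x ≢ u → x′ ≢ u → x′ ≢ x → w ~ x → Solution S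
        square x∈S x′∈S v~x v~x′ x≢ x′≢ x′≢x w~x with at-w w~x
        ... | at0 = ⊥-elim (x≢ refl)
        ... | at1 = Square.solution u∈S v∈S w∈S x∈S x′∈S y′∈S u~v u~w v≢w nu v~x v~x′ w~y w~y′ x≢ x′≢ y′≢ x′≢x y′≢y
        ... | at2 = Square.solution u∈S v∈S w∈S x∈S x′∈S y∈S u~v u~w v≢w nu v~x v~x′ w~y′ w~y x≢ x′≢ y≢ x′≢x (≢-sym y′≢y)
        choose : Solution S
        choose with w ~? x | w ~? x′
        ... | yes w~x | _ = square x∈S x′∈S v~x v~x′ x≢ x′≢ x′≢x w~x
        ... | _ | yes w~x′ = square x′∈S x∈S v~x′ v~x x′≢ x≢ (≢-sym x′≢x) w~x′
        ... | no w≁x | no w≁x′ = fork-solution (record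
          { u∈S = u∈S ; v∈S = v∈S ; w∈S = w∈S ; x∈S = x∈S ; x′∈S = x′∈S ; y∈S = y∈S ; y′∈S = y′∈S
          ; u~v = u~v ; u~w = u~w ; v≢w = v≢w ; nu = nu ; v~x = v~x ; v~x′ = v~x′
          ; x≢u = x≢ ; x′≢u = x′≢ ; x≢x′ = ≢-sym x′≢x ; w~y = w~y ; w~y′ = w~y′
          ; y≢u = y≢ ; y′≢u = y′≢ ; y≢y′ = ≢-sym y′≢y ; v≁w = v≁ ; w≁x = w≁x ; w≁x′ = w≁x′ })

    degree-two-solution : ∀ {u v w} → u ∈ S → v ∈ S → w ∈ S → u ~ v → u ~ w → v ≢ w → Neighbours⊆ S u (v ∷ w ∷ []) → Solution S
    degree-two-solution with Fin.any? (λ u → Fin.any? λ v → Fin.any? λ w → Fin.any? λ x → tight? S u v w x)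
    ... | yes (_ , _ , _ , _ , tight) = λ _ _ _ _ _ _ _ → tight-solution tight
    ... | no noTight = Branching.solution (λ tight → noTight (_ , _ , _ , _ , tight))

  -- Handshake lemma

  degreeIn : List (Fin n) → Fin n → ℕ
  degreeIn L v = length (filter (v ~?_) L)

  -- Keeping the two lists separate allows the induction to enlarge them one at a time; when they
  -- agree, each edge is counted from both ends.
  degreeSum : List (Fin n) → List (Fin n) → ℕ
  degreeSum A B = sum (map (degreeIn B) A)

  degreeIn-sym : ∀ {x v} A B → length (filter (v ~?_) (x ∷ B)) + length (filter (x ~?_) A) ≡
    length (filter (x ~?_) (v ∷ A)) + length (filter (v ~?_) B)
  degreeIn-sym {x} {v} A B with adj G v x | adj G x v | adj-sym G v x
  ... | true  | .true  | refl = cong suc (+-comm (length (filter (v ~?_) B)) _)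
  ... | false | .false | refl = +-comm (length (filter (v ~?_) B)) _

  degreeSum-∷ : ∀ x A B → degreeSum A (x ∷ B) ≡ degreeIn A x + degreeSum A B
  degreeSum-∷ x []      B = refl
  degreeSum-∷ x (v ∷ A) B = begin
    degreeIn (x ∷ B) v + degreeSum A (x ∷ B)                ≡⟨ cong (degreeIn (x ∷ B) v +_) (degreeSum-∷ x A B) ⟩
    degreeIn (x ∷ B) v + (degreeIn A x + degreeSum A B)     ≡⟨ +-assoc (degreeIn (x ∷ B) v) _ _ ⟨
    degreeIn (x ∷ B) v + degreeIn A x + degreeSum A B       ≡⟨ cong (_+ degreeSum A B) (degreeIn-sym A B) ⟩
    degreeIn (v ∷ A) x + degreeIn B v + degreeSum A B       ≡⟨ +-assoc (degreeIn (v ∷ A) x) _ _ ⟩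
    degreeIn (v ∷ A) x + (degreeIn B v + degreeSum A B)     ∎
    where open ≡-Reasoning

  degreeSum-even : ∀ L → 2 ∣ degreeSum L L
  degreeSum-even [] = 2 ∣0
  degreeSum-even (x ∷ L) = subst (2 ∣_) (sym split) (∣m∣n⇒∣m+n (m∣m*n (degreeIn L x)) (degreeSum-even L))
    where
    open ≡-Reasoning
    loopless : degreeIn (x ∷ L) x ≡ degreeIn L x
    loopless = cong length (List.filter-reject (x ~?_) {x = x} {xs = L} λ x~x → ~⇒≢ x~x refl)
    rearrange : ∀ d s → d + (d + s) ≡ 2 * d + s
    rearrange = solve-∀
    split : degreeSum (x ∷ L) (x ∷ L) ≡ 2 * degreeIn L x + degreeSum L L
    split = begin
      degreeIn (x ∷ L) x + degreeSum L (x ∷ L)             ≡⟨ cong₂ _+_ loopless (degreeSum-∷ x L L) ⟩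
      degreeIn L x + (degreeIn L x + degreeSum L L)        ≡⟨ rearrange (degreeIn L x) (degreeSum L L) ⟩
      2 * degreeIn L x + degreeSum L L                     ∎

  -- Cubic vertex sets

  CubicAt : List (Fin n) → Fin n → Set
  CubicAt S v = ∃ λ a → ∃ λ b → ∃ λ c → (a ∈ S × b ∈ S × c ∈ S) × (v ~ a × v ~ b × v ~ c) × a ≢ b × a ≢ c × b ≢ c

  cubic-degree : ∀ {S v} → Unique S → CubicAt S v → degreeIn S v ≡ 3
  cubic-degree {S} {v} S! (a , b , c , (a∈ , b∈ , c∈) , (v~a , v~b , v~c) , a≢b , a≢c , b≢c) = ≤-antisym
    (neighbours≤3 (Unique.filter⁺ (v ~?_) S!) (all-filter (v ~?_) S))
    (⊆-length (unique3 a≢b a≢c b≢c) λ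
      { at0 → ∈-filter⁺ (v ~?_) a∈ v~a ; at1 → ∈-filter⁺ (v ~?_) b∈ v~b ; at2 → ∈-filter⁺ (v ~?_) c∈ v~c })

  constant-sum : ∀ {f : Fin n → ℕ} L → (∀ {v} → v ∈ L → f v ≡ 3) → sum (map f L) ≡ length L * 3
  constant-sum []      _  = refl
  constant-sum (v ∷ L) f≡3 = cong₂ _+_ (f≡3 at0) (constant-sum L (f≡3 ∘ there))

  cubic-even : ∀ {S} → Unique S → (∀ {v} → v ∈ S → CubicAt S v) → 2 ∣ length S * 3
  cubic-even {S} S! cubic =
    subst (2 ∣_) (constant-sum S (λ v∈ → cubic-degree S! (cubic v∈))) (degreeSum-even S)

  cubic-solution : ∀ {S} → Unique S → (∀ T → Unique T → length T < length S → Solution T) →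
    Clean S → (∀ {v} → v ∈ S → CubicAt S v) → Solution S
  cubic-solution {[]} _ _ _ _ = record
    { size = 0 ; matching = empty-matching ; debts = [] ; bads = [] ; apart = [] ; bound = z≤n }
  cubic-solution {S@(x ∷ _)} S! solve clean cubic = conclude (solve T (∖-unique S!) (∖-shrinks at0 at0))
    where
    open Cleaned clean
    T = S ∖ (x ∷ [])

    x~leg : ∀ {p q a b c} → BadTheta T p q a b c → x ~ c
    x~leg t with touch t
    ... | _ , at0 , _ , c~x = ~-sym c~x

    x≢ : ∀ {κ vs} → Bad κ T vs → ∀ i → lookup vs i ≢ x
    x≢ bad i eq = bad∉ bad i (here eq)

    -- A vertex with three neighbours is not isolated by the loss of `x`. The legs of a new K₂,₃
    -- would all be adjacent to `x`, so that `x` as a third hub would complete a K₃,₃ in `S`.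
    noBad′ : NoBad T
    noBad′ κ vs bad with view bad
    ... | isolated b∈ _ nb with cubic b∈
    ...   | _ , _ , _ , (a∈ , b∈ , _) , (~a , ~b , _) , a≢b , _ with nb a∈ ~a | nb b∈ ~b
    ...     | at0 | at0 = a≢b refl
    noBad′ _ _ bad | attached-theta t = noBad k33 _ record { copy = k ; closed = λ i _ → k33-neighbours k i }
      where
      c = copy t
      k = k33-copy (bad∈ t 0F ∷ bad∈ t 1F ∷ at0 ∷ bad∈ t 2F ∷ bad∈ t 3F ∷ bad∈ t 4F ∷ [])
        (distinct c 0F 1F (λ ())) (x≢ t 0F) (x≢ t 1F)
        (distinct c 2F 3F (λ ())) (distinct c 2F 4F (λ ())) (distinct c 3F 4F (λ ()))
        (edge c 0F 2F refl) (edge c 0F 3F refl) (edge c 0F 4F refl)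
        (edge c 1F 2F refl) (edge c 1F 3F refl) (edge c 1F 4F refl)
        (x~leg (rotate-bad t)) (x~leg (rotate-bad (rotate-bad t))) (x~leg t)

    conclude : Solution T → Solution S
    conclude record { debts = (κ , vs) ∷ _ ; bads = bad ∷ _ } = ⊥-elim (noBad′ κ vs bad)
    conclude record { size = k ; matching = M ; debts = [] ; bound = T≤ } = record
      { size = k ; matching = matching-mono ∖-⊆ M ; debts = [] ; bads = [] ; apart = []
      ; bound = subst (length S ≤_) (sym (+-identityʳ (4 * k))) (≤-pred (≤∧≢⇒< S≤ odd)) }
      where
      S≤ : length S ≤ suc (4 * k)
      S≤ = ≤-trans (∖-length {X = x ∷ []} S!) (≤-trans (+-monoˡ-≤ 1 T≤) (≤-reflexive (rearrange k)))
        where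
        rearrange : ∀ k → 4 * k + 0 + 1 ≡ suc (4 * k)
        rearrange = solve-∀
      -- The degree sum is three times the length of `S` and even, whereas 3(4k + 1) = 2 · 6k + 3 is
      -- odd.
      odd : length S ≢ suc (4 * k)
      odd eq = from-no (2 ∣? 3) (∣m+n∣m⇒∣n (subst (2 ∣_) (trans (cong (_* 3) eq) (rearrange k)) (cubic-even S! cubic))
        (m∣m*n (6 * k)))
        where
        rearrange : ∀ k → suc (4 * k) * 3 ≡ 2 * (6 * k) + 3
        rearrange = solve-∀

  -- The induction

  first : ∀ κ → Fin (order κ)
  first point = 0F
  first theta = 0F
  first k4+   = 0F
  first k33   = 0F

  module Induction {S : List (Fin n)} (S! : Unique S) (solve : ∀ T → Unique T → length T < length S → Solution T) where

    peel-first : ∀ {κ vs} → Bad κ S vs → Solution S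
    peel-first {κ} {vs} bad = peel S! bad
      (solve _ (∖-unique S!) (∖-shrinks (member (copy bad) (first κ)) (lookup∈ vs (first κ))))

    branch : Clean S → Solution S
    branch clean with Fin.any? (λ v → Fin.any? λ u → (v ∈? S) ×-dec isLeaf? S v u)
    ... | yes (_ , _ , v∈S , leaf) = Leaves.leaf-solution S! solve clean v∈S leaf
    ... | no noLeaf with Fin.any? (λ u → Fin.any? λ v → Fin.any? λ w → (u ∈? S) ×-dec (v ∈? S) ×-dec (w ∈? S)
                           ×-dec (u ~? v) ×-dec (u ~? w) ×-dec ¬? (v ≟ w) ×-dec neighbours⊆? S u (v ∷ w ∷ []))
    ...   | yes (_ , _ , _ , u∈ , v∈ , w∈ , u~v , u~w , v≢w , nu) =
      DegreeTwo.degree-two-solution S! solve clean (λ v∈ leaf → noLeaf (_ , _ , v∈ , leaf)) u∈ v∈ w∈ u~v u~w v≢w nu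
    ...   | no noTwo = cubic-solution S! solve clean cubic
      where
      cubic : ∀ {v} → v ∈ S → CubicAt S v
      cubic {v} v∈ with Cleaned.neighbour clean v∈
      ... | a , a∈ , v~a with beyond? S v (a ∷ [])
      ...   | inj₂ nv = ⊥-elim (noLeaf (_ , _ , a∈ , v∈ , v~a , nv))
      ...   | inj₁ (b , b∈ , v~b , b∉) with beyond? S v (a ∷ b ∷ [])
      ...     | inj₂ nv = ⊥-elim (noTwo (_ , _ , _ , v∈ , a∈ , b∈ , v~a , v~b , (λ { refl → b∉ at0 }) , nv))
      ...     | inj₁ (c , c∈ , v~c , c∉) = a , b , c , (a∈ , b∈ , c∈) , (v~a , v~b , v~c) ,
        (λ { refl → b∉ at0 }) , (λ { refl → c∉ at0 }) , λ { refl → c∉ at1 }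

    FreeLeg : Vec (Fin n) 5 → Fin 5 → Set
    FreeLeg vs i = Leg S (lookup vs 0F) (lookup vs 1F) (lookup vs i)

    freeLeg? : ∀ vs i → Dec (FreeLeg vs i)
    freeLeg? vs i = neighbours⊆? S (lookup vs i) (lookup vs 0F ∷ lookup vs 1F ∷ [])

    module _ (noBad : NoBad S) (noK4+ : ∀ vs → ¬ Copy k4+ S vs) where

      clean-up : (∀ {p q a b c} → Copy theta S (p ∷ q ∷ a ∷ b ∷ c ∷ []) → Leg S p q b → ¬ Leg S p q c) → Solution S
      -- The search runs over all orderings of a copy, so testing the last position finds a free leg
      -- wherever it is.
      clean-up noPendant with anyVec? (λ vs → copy? theta S vs ×-dec freeLeg? vs 4F)
      ... | no noFree = branch record
        { noBad = noBad ; noK4+ = noK4+ ; noFreeLeg = λ t fc → noFree (_ , t , fc) }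
      ... | yes (p ∷ q ∷ a ∷ b ∷ c ∷ [] , t , fc) with beyond? S a (p ∷ q ∷ []) | beyond? S b (p ∷ q ∷ [])
      ...   | inj₂ fa | _       = ⊥-elim (noPendant (rotate t) fc fa)
      ...   | _       | inj₂ fb = ⊥-elim (noPendant t fb fc)
      ...   | inj₁ (x , x∈ , a~x , x∉) | inj₁ (y , y∈ , b~y , y∉) =
        Pendant.TwoAttached.solution S! solve noBad noK4+ noPendant t fc x∈ a~x x∉ y∈ b~y y∉

      no-k4+ : Solution S
      no-k4+ with anyVec? (λ vs → copy? theta S vs ×-dec freeLeg? vs 3F ×-dec freeLeg? vs 4F)
      ... | yes (p ∷ q ∷ a ∷ b ∷ c ∷ [] , t , fb , fc) = Pendant.pendant-theta S! solve noBad t fb fc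
      ... | no noPendant = clean-up λ t fb fc → noPendant (_ , t , fb , fc)

    advance : Solution S
    advance with findBad S
    ... | inj₁ (_ , _ , bad) = peel-first bad
    ... | inj₂ noBad with anyVec? (copy? k4+ S)
    ...   | yes (_ ∷ _ ∷ _ ∷ _ ∷ _ ∷ [] , t) = Pendant.PendantK4+.solution S! solve noBad t
    ...   | no noK4+ = no-k4+ noBad λ vs t → noK4+ (vs , t)

  solve-below : ∀ m S → Unique S → length S < m → Solution S
  solve-below zero    S S! ()
  solve-below (suc m) S S! (s≤s S≤m) = Induction.advance S! λ T T! T<S → solve-below m T T! (≤-trans T<S S≤m)

  -- Counting components

  kindIndex : Kind → Fin 4
  kindIndex point = 0F
  kindIndex theta = 1F
  kindIndex k4+   = 2F
  kindIndex k33   = 3F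

  kindAt : Fin 4 → Kind
  kindAt 0F = point
  kindAt 1F = theta
  kindAt 2F = k4+
  kindAt 3F = k33

  kindAt-index : ∀ κ → kindAt (kindIndex κ) ≡ κ
  kindAt-index point = refl
  kindAt-index theta = refl
  kindAt-index k4+   = refl
  kindAt-index k33   = refl

  _≟ᵏ_ : (κ κ′ : Kind) → Dec (κ ≡ κ′)
  κ ≟ᵏ κ′ = map′ (λ eq → trans (sym (kindAt-index κ)) (trans (cong kindAt eq) (kindAt-index κ′))) (cong kindIndex)
    (kindIndex κ Fin.≟ kindIndex κ′)

  ofKind : Kind → List Debt → List Debt
  ofKind κ = filter (λ d → proj₁ d ≟ᵏ κ)

  # : Kind → List Debt → ℕ
  # κ ds = length (ofKind κ ds)

  total-split : ∀ ds → total ds ≡ # point ds + # theta ds + # k4+ ds + 2 * # k33 ds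
  total-split [] = refl
  total-split ((point , _) ∷ ds) = cong suc (total-split ds)
  total-split ((theta , _) ∷ ds) = trans (cong suc (total-split ds)) (r (# point ds) (# theta ds) (# k4+ ds) (# k33 ds))
    where
    r : ∀ p t k l → suc (p + t + k + 2 * l) ≡ p + suc t + k + 2 * l
    r = solve-∀
  total-split ((k4+ , _) ∷ ds) = trans (cong suc (total-split ds)) (r (# point ds) (# theta ds) (# k4+ ds) (# k33 ds))
    where
    r : ∀ p t k l → suc (p + t + k + 2 * l) ≡ p + t + suc k + 2 * l
    r = solve-∀
  total-split ((k33 , _) ∷ ds) = trans (cong (2 +_) (total-split ds)) (r (# point ds) (# theta ds) (# k4+ ds) (# k33 ds))
    where
    r : ∀ p t k l → 2 + (p + t + k + 2 * l) ≡ p + t + k + 2 * suc l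
    r = solve-∀

  walk-append : ∀ {u v w} → Walk G u v → Walk G v w → Walk G u w
  walk-append here        q = q
  walk-append (step e p)  q = step e (walk-append p q)

  walk-reverse : ∀ {u v} → Walk G u v → Walk G v u
  walk-reverse here       = here
  walk-reverse (step e p) = walk-append (walk-reverse p) (step (~-sym e) here)

  walk-to-first : ∀ {κ S vs} → Copy κ S vs → ∀ i → Walk G (lookup vs i) (lookup vs (first κ))
  walk-to-first {point} c 0F = here
  walk-to-first {theta} c 0F = here
  walk-to-first {theta} c 1F = step (edge c 1F 2F refl) (step (edge c 2F 0F refl) here)
  walk-to-first {theta} c 2F = step (edge c 2F 0F refl) here
  walk-to-first {theta} c 3F = step (edge c 3F 0F refl) here
  walk-to-first {theta} c 4F = step (edge c 4F 0F refl) here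
  walk-to-first {k4+}   c 0F = here
  walk-to-first {k4+}   c 1F = step (edge c 1F 2F refl) (step (edge c 2F 0F refl) here)
  walk-to-first {k4+}   c 2F = step (edge c 2F 0F refl) here
  walk-to-first {k4+}   c 3F = step (edge c 3F 0F refl) here
  walk-to-first {k4+}   c 4F = step (edge c 4F 0F refl) here
  walk-to-first {k33}   c 0F = here
  walk-to-first {k33}   c 1F = step (edge c 1F 3F refl) (step (edge c 3F 0F refl) here)
  walk-to-first {k33}   c 2F = step (edge c 2F 3F refl) (step (edge c 3F 0F refl) here)
  walk-to-first {k33}   c 3F = step (edge c 3F 0F refl) here
  walk-to-first {k33}   c 4F = step (edge c 4F 0F refl) here
  walk-to-first {k33}   c 5F = step (edge c 5F 0F refl) here

  subset : List (Fin n) → Subset n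
  subset L = tabulate (λ v → does (v ∈? L))

  subset⁺ : ∀ {v L} → v ∈ L → v ∈ₛ subset L
  subset⁺ {v} {L} v∈ = trans (Vec.lookup∘tabulate _ v) (dec-true (v ∈? L) v∈)

  subset⁻ : ∀ {v L} → v ∈ₛ subset L → v ∈ L
  subset⁻ {v} {L} v∈ with v ∈? L | Vec.lookup∘tabulate (λ v → does (v ∈? L)) v
  ... | yes v∈L | _  = v∈L
  ... | no  _   | eq = case trans (sym eq) v∈ of λ ()

  bad-component : ∀ {κ vs} → Bad κ (allFin n) vs →
    IsComponent G (subset (toList vs)) × InducedIso G (subset (toList vs)) (shape κ)
  bad-component {κ} {vs} b = (nonempty , escape , connected) ,
    lookup vs , injective (copy b) , cover , (λ i → subset⁺ (lookup∈ vs i)) , adjacency (copy b)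
    where
    C = subset (toList vs)
    nonempty : ∃ λ v → v ∈ₛ C
    nonempty = lookup vs (first κ) , subset⁺ (lookup∈ vs (first κ))
    cover : ∀ v → v ∈ₛ C → ∃ λ i → lookup vs i ≡ v
    cover v v∈ with index vs (subset⁻ v∈)
    ... | i , eq = i , sym eq
    escape : ∀ u v → u ∈ₛ C → u ~ v → v ∈ₛ C
    escape u v u∈ u~v with cover u u∈
    ... | i , refl = subset⁺ (closed b i (∈-allFin v) u~v)
    connected : ∀ u v → u ∈ₛ C → v ∈ₛ C → Walk G u v
    connected u v u∈ v∈ with cover u u∈ | cover v v∈
    ... | i , refl | j , refl = walk-append (walk-to-first (copy b) i) (walk-reverse (walk-to-first (copy b) j))

  -- Disjoint nonempty supports are distinct vertex sets, and each is a component of the given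
  -- shape, hence occurs in `L`.
  #≤count : ∀ κ {c ds} → CountComponents G (shape κ) c →
    All (λ d → Bad (proj₁ d) (allFin n) (proj₂ d)) ds → AllPairs Apart ds → # κ ds ≤ c
  #≤count κ {ds = ds} (L , _ , refl , L⇔) bads apart = begin
    # κ ds                                        ≡⟨ List.length-map (subset ∘ support) (ofKind κ ds) ⟨
    length (map (subset ∘ support) (ofKind κ ds)) ≤⟨ ⊆-length distinct-subsets included ⟩
    length L                                      ∎
    where
    open ≤-Reasoning
    separate : ∀ {d e} → Apart d e → subset (support d) ≢ subset (support e)
    separate {κ , vs} {e} ap eq = ap (lookup∈ vs (first κ))
      (subset⁻ (subst (lookup vs (first κ) ∈ₛ_) eq (subset⁺ (lookup∈ vs (first κ)))))
    distinct-subsets : Unique (map (subset ∘ support) (ofKind κ ds))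
    distinct-subsets = AllPairs.map⁺ (AllPairs.filter⁺ _ (Pairs.map separate apart))
    included : map (subset ∘ support) (ofKind κ ds) ⊆ L
    included C∈ with ∈-map⁻ (subset ∘ support) C∈
    ... | (κ′ , vs) , d∈ , refl with ∈-filter⁻ (λ d → proj₁ d ≟ᵏ κ) {xs = ds} d∈
    ...   | d∈ds , refl = Equivalence.from (L⇔ _) (bad-component (All.lookup bads d∈ds))

  no-points : NoIsolatedVertices G → ∀ {ds} → All (λ d → Bad (proj₁ d) (allFin n) (proj₂ d)) ds → # point ds ≡ 0
  no-points noIso [] = refl
  no-points noIso {(point , v ∷ []) ∷ ds} (b ∷ _) with noIso v
  ... | w , v~w with closed b 0F (∈-allFin w) v~w
  ...   | at0 = ⊥-elim (~⇒≢ v~w refl)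
  no-points noIso {(theta , _) ∷ ds} (_ ∷ bs) = no-points noIso bs
  no-points noIso {(k4+   , _) ∷ ds} (_ ∷ bs) = no-points noIso bs
  no-points noIso {(k33   , _) ∷ ds} (_ ∷ bs) = no-points noIso bs

  acyclic-matching-bound : NoIsolatedVertices G → ∀ a b c →
    CountComponents G K23 a → CountComponents G K4plus b → CountComponents G K33 c →
    Σ (List (Fin n × Fin n)) λ M → IsAcyclicMatching G M × n ≤ 4 * length M + a + b + 2 * c
  acyclic-matching-bound noIso a b c ca cb cc = edges matching , acyclic matching , (begin
    n                                                     ≡⟨ List.length-tabulate id ⟨
    length (allFin n)                                     ≤⟨ bound ⟩
    4 * size + total debts                                ≡⟨ cong (4 * size +_) (trans (total-split debts) (cong (λ p → p + # theta debts + # k4+ debts + 2 * # k33 debts) (no-points noIso bads))) ⟩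
    4 * size + (# theta debts + # k4+ debts + 2 * # k33 debts)
      ≤⟨ +-monoʳ-≤ (4 * size) (+-mono-≤ (+-mono-≤ (#≤count theta ca bads apart) (#≤count k4+ cb bads apart)) (*-monoʳ-≤ 2 (#≤count k33 cc bads apart))) ⟩
    4 * size + (a + b + 2 * c)                            ≡⟨ reassociate (4 * size) a b (2 * c) ⟩
    4 * size + a + b + 2 * c                              ≡⟨ cong (λ k → 4 * k + a + b + 2 * c) (length≡ matching) ⟨
    4 * length (edges matching) + a + b + 2 * c           ∎)
    where
    open ≤-Reasoning
    open Solution (solve-below (suc (length (allFin n))) (allFin n) (Unique.allFin⁺ n) ≤-refl)
    reassociate : ∀ s a b c → s + (a + b + c) ≡ s + a + b + c
    reassociate = solve-∀

theorem2 : ∀ {n} (G : Graph n) → Subcubic G → NoIsolatedVertices G →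
    ∀ (a b c : ℕ) → CountComponents G K23 a → CountComponents G K4plus b →
    CountComponents G K33 c →
    Σ (List (Fin n × Fin n)) λ M → IsAcyclicMatching G M ×
    n ≤ 4 * length M + a + b + 2 * c
theorem2 G subcubic = Local.acyclic-matching-bound G subcubic
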